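{- Let $F$ be any subfield of $\mathbb{R}$ and $r\in F$. Then (1) $T[F]$ proves $\forall x\,(x\le r\rightarrow x^2-2x+1\ge0)$ if and only if $r<1$; and (2) $T[F]$ proves $\forall x\,(x\ge r\rightarrow x^2-2x+1\ge0)$ if and only if $r>1$.
   Context: For $a\in F$, $f_a$ is a unary function symbol interpreted as $f_a(x)=ax$; a constant $c\in F$ is denoted by the term $f_c(1)$. $x^2$ denotes $x\times x$ and $2x$ denotes $f_2(x)$. $T_{\mathrm{add}}[F]$ is the set of sentences true in $(\mathbb{R},0,1,+,-,<,(f_a)_{a\in F})$, $T_{\mathrm{mult}}[F]$ the set of sentences true in $(\mathbb{R},0,1,\times,\div,<,(f_a)_{a\in F})$ with $x\div0=0$, and $T[F]=T_{\mathrm{add}}[F]\cup T_{\mathrm{mult}}[F]$, a theory in the union of the two languages. -}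

module Defs where

open import Level using (0ℓ) renaming (suc to lsuc)
open import Algebra.Bundles using (CommutativeRing)
open import Data.Empty using (⊥)
open import Data.Fin.Base using (Fin)
open import Data.Fin.Substitution
  using (Sub; Lift; TermSubst)
open import Data.List.Base as List using (List; []; _∷_)
open import Data.List.Membership.Propositional using (_∈_)
open import Data.Nat.Base using (ℕ; suc)
open import Data.Product.Base using (∃; _×_; _,_; proj₁)
open import Data.Sum.Base using (_⊎_)
open import Data.Vec.Base as Vec using (Vec; []; _∷_)
open import Relation.Binary.Core using (Rel)
open import Relation.Binary.Definitions using (_Respects_)
open import Relation.Binary.PropositionalEquality using (_≡_)
open import Relation.Binary.Structures using (IsStrictTotalOrder)
import Relation.Binary.Construct.StrictToNonStrict as StrictToNonStrict
open import Relation.Nullary using (¬_; yes; no)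
open import Relation.Unary using (Pred; _∪_; Satisfiable)

------------------------------------------------------------------------
-- The real numbers

-- The reals are given axiomatically, as a Dedekind-complete ordered
-- field; classically, any two such fields are isomorphic.

record CompleteOrderedField : Set (lsuc 0ℓ) where
  infix 4 _<_
  field
    commutativeRing : CommutativeRing 0ℓ 0ℓ

  open CommutativeRing commutativeRing public

  field
    _<_                : Rel Carrier 0ℓ
    isStrictTotalOrder : IsStrictTotalOrder _≈_ _<_

  open IsStrictTotalOrder isStrictTotalOrder public
    using (compare; _≟_; _<?_)

  infix 4 _>_

  _>_ : Rel Carrier 0ℓ
  x > y = y < x

  open StrictToNonStrict _≈_ _<_ public
    using (_≤_)

  _IsUpperBoundOf_ : Carrier → Pred Carrier 0ℓ → Set
  b IsUpperBoundOf S = ∀ {x} → S x → x ≤ b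

  _IsSupremumOf_ : Carrier → Pred Carrier 0ℓ → Set
  s IsSupremumOf S =
    s IsUpperBoundOf S × (∀ {b} → b IsUpperBoundOf S → s ≤ b)

  field
    0<1      : 0# < 1#
    inverse  : ∀ x → ¬ x ≈ 0# → ∃ λ y → x * y ≈ 1#
    +-mono-< : ∀ {x y} z → x < y → x + z < y + z
    *-pos    : ∀ {x y} → 0# < x → 0# < y → 0# < x * y
    complete : (S : Pred Carrier 0ℓ) → Satisfiable S →
               Satisfiable (_IsUpperBoundOf S) →
               Satisfiable (_IsSupremumOf S)

  infixl 7 _÷_

  _÷_ : Carrier → Carrier → Carrier
  x ÷ y with y ≟ 0#
  ... | yes _   = 0#
  ... | no  y≉0 = x * proj₁ (inverse y y≉0)

record Subfield (ℝ : CompleteOrderedField) : Set (lsuc 0ℓ) where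
  open CompleteOrderedField ℝ
  field
    Member     : Pred Carrier 0ℓ
    respects   : Member Respects _≈_
    0-closed   : Member 0#
    1-closed   : Member 1#
    +-closed   : ∀ {x y} → Member x → Member y → Member (x + y)
    neg-closed : ∀ {x} → Member x → Member (- x)
    *-closed   : ∀ {x y} → Member x → Member y → Member (x * y)
    inv-closed : ∀ {x y} → Member x → x * y ≈ 1# → Member y

  -- Scalars index the function symbols f_a.  Different representatives
  -- of one element of F give different symbols for the same function,
  -- and the theories below prove them equal.
  Scalar : Set
  Scalar = ∃ Member

------------------------------------------------------------------------
-- First-order logic with equality

record Language : Set₁ where
  field
    Function : ℕ → Set
    Relation : ℕ → Set

open Language

-- Variables are de Bruijn indices: `Term L n` and `Formula L n` have
-- their free variables among the n elements of `Fin n`.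

data Term (L : Language) (n : ℕ) : Set where
  var : Fin n → Term L n
  app : ∀ {k} → Function L k → Vec (Term L n) k → Term L n

infix  8 _≐_
infixr 7 _∧′_
infixr 6 _∨′_
infixr 5 _⇒′_

data Formula (L : Language) (n : ℕ) : Set where
  ⊥′             : Formula L n
  _≐_            : Term L n → Term L n → Formula L n
  rel            : ∀ {k} → Relation L k → Vec (Term L n) k → Formula L n
  _∧′_ _∨′_ _⇒′_ : Formula L n → Formula L n → Formula L n
  ∀′ ∃′          : Formula L (suc n) → Formula L n

Sentence : Language → Set
Sentence L = Formula L 0

Theory : Language → Set₁
Theory L = Pred (Sentence L) 0ℓ

module _ {L : Language} where

  module TermApplication {T : Pred ℕ 0ℓ} (l : Lift T (Term L)) where
    open Lift l using (lift)

    infixl 9 _/_ _/*_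

    mutual
      _/_ : ∀ {m n} → Term L m → Sub T m n → Term L n
      var x    / ρ = lift (Vec.lookup ρ x)
      app f ts / ρ = app f (ts /* ρ)

      _/*_ : ∀ {m n k} → Vec (Term L m) k → Sub T m n → Vec (Term L n) k
      []       /* ρ = []
      (t ∷ ts) /* ρ = (t / ρ) ∷ (ts /* ρ)

  termSubst : TermSubst (Term L)
  termSubst = record { var = var ; app = TermApplication._/_ }

  open TermSubst termSubst public
    using (_/_; _↑; wk; sub; termLift)
  open TermApplication termLift public
    using (_/*_)

  infixl 9 _/ᶠ_

  _/ᶠ_ : ∀ {m n} → Formula L m → Sub (Term L) m n → Formula L n
  ⊥′       /ᶠ ρ = ⊥′
  (s ≐ t)  /ᶠ ρ = (s / ρ) ≐ (t / ρ)
  rel R ts /ᶠ ρ = rel R (ts /* ρ)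
  (φ ∧′ ψ) /ᶠ ρ = (φ /ᶠ ρ) ∧′ (ψ /ᶠ ρ)
  (φ ∨′ ψ) /ᶠ ρ = (φ /ᶠ ρ) ∨′ (ψ /ᶠ ρ)
  (φ ⇒′ ψ) /ᶠ ρ = (φ /ᶠ ρ) ⇒′ (ψ /ᶠ ρ)
  ∀′ φ     /ᶠ ρ = ∀′ (φ /ᶠ ρ ↑)
  ∃′ φ     /ᶠ ρ = ∃′ (φ /ᶠ ρ ↑)

  wkᶠ : ∀ {n} → Formula L n → Formula L (suc n)
  wkᶠ φ = φ /ᶠ wk

  -- Classical natural deduction from the axioms T, where Γ lists the
  -- open assumptions.

  infix 4 _∣_⊢_ _⊢_

  data _∣_⊢_ (T : Theory L) :
             ∀ {n} → List (Formula L n) → Formula L n → Set where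
    axiom : ∀ {n} {Γ : List (Formula L n)} {σ} →
            T σ → T ∣ Γ ⊢ σ /ᶠ []
    hyp   : ∀ {n} {Γ : List (Formula L n)} {φ} →
            φ ∈ Γ → T ∣ Γ ⊢ φ
    raa   : ∀ {n} {Γ : List (Formula L n)} {φ} →
            T ∣ (φ ⇒′ ⊥′) ∷ Γ ⊢ ⊥′ → T ∣ Γ ⊢ φ
    ∧-i   : ∀ {n} {Γ : List (Formula L n)} {φ ψ} →
            T ∣ Γ ⊢ φ → T ∣ Γ ⊢ ψ → T ∣ Γ ⊢ φ ∧′ ψ
    ∧-e₁  : ∀ {n} {Γ : List (Formula L n)} {φ ψ} →
            T ∣ Γ ⊢ φ ∧′ ψ → T ∣ Γ ⊢ φ
    ∧-e₂  : ∀ {n} {Γ : List (Formula L n)} {φ ψ} →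
            T ∣ Γ ⊢ φ ∧′ ψ → T ∣ Γ ⊢ ψ
    ∨-i₁  : ∀ {n} {Γ : List (Formula L n)} {φ ψ} →
            T ∣ Γ ⊢ φ → T ∣ Γ ⊢ φ ∨′ ψ
    ∨-i₂  : ∀ {n} {Γ : List (Formula L n)} {φ ψ} →
            T ∣ Γ ⊢ ψ → T ∣ Γ ⊢ φ ∨′ ψ
    ∨-e   : ∀ {n} {Γ : List (Formula L n)} {φ ψ χ} →
            T ∣ Γ ⊢ φ ∨′ ψ → T ∣ φ ∷ Γ ⊢ χ → T ∣ ψ ∷ Γ ⊢ χ → T ∣ Γ ⊢ χ
    ⇒-i   : ∀ {n} {Γ : List (Formula L n)} {φ ψ} →
            T ∣ φ ∷ Γ ⊢ ψ → T ∣ Γ ⊢ φ ⇒′ ψ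
    ⇒-e   : ∀ {n} {Γ : List (Formula L n)} {φ ψ} →
            T ∣ Γ ⊢ φ ⇒′ ψ → T ∣ Γ ⊢ φ → T ∣ Γ ⊢ ψ
    ∀-i   : ∀ {n} {Γ : List (Formula L n)} {φ} →
            T ∣ List.map wkᶠ Γ ⊢ φ → T ∣ Γ ⊢ ∀′ φ
    ∀-e   : ∀ {n} {Γ : List (Formula L n)} {φ} (t : Term L n) →
            T ∣ Γ ⊢ ∀′ φ → T ∣ Γ ⊢ φ /ᶠ sub t
    ∃-i   : ∀ {n} {Γ : List (Formula L n)} {φ} (t : Term L n) →
            T ∣ Γ ⊢ φ /ᶠ sub t → T ∣ Γ ⊢ ∃′ φ
    ∃-e   : ∀ {n} {Γ : List (Formula L n)} {φ ψ} →
            T ∣ Γ ⊢ ∃′ φ → T ∣ φ ∷ List.map wkᶠ Γ ⊢ wkᶠ ψ → T ∣ Γ ⊢ ψ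
    ≐-refl  : ∀ {n} {Γ : List (Formula L n)} {t} →
              T ∣ Γ ⊢ t ≐ t
    ≐-subst : ∀ {n} {Γ : List (Formula L n)} {s t}
              (φ : Formula L (suc n)) →
              T ∣ Γ ⊢ s ≐ t → T ∣ Γ ⊢ φ /ᶠ sub s → T ∣ Γ ⊢ φ /ᶠ sub t

  _⊢_ : Theory L → Sentence L → Set
  T ⊢ σ = T ∣ [] ⊢ σ

-- The symbol ≐ is interpreted by the given relation _≈_.  Satisfaction
-- needs no laws, so none are required here.  The satisfaction relation is
-- Tarski's, and is the classical one in the presence of excluded middle.

record RawStructure (L : Language) : Set₁ where
  infix 4 _≈_
  field
    Carrier : Set
    _≈_     : Rel Carrier 0ℓ
    ⟦_⟧ᶠ    : ∀ {k} → Function L k → Vec Carrier k → Carrier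
    ⟦_⟧ʳ    : ∀ {k} → Relation L k → Vec Carrier k → Set

module _ {L : Language} (M : RawStructure L) where
  open RawStructure M

  mutual
    eval : ∀ {n} → Vec Carrier n → Term L n → Carrier
    eval η (var x)    = Vec.lookup η x
    eval η (app f ts) = ⟦ f ⟧ᶠ (evals η ts)

    evals : ∀ {n k} → Vec Carrier n → Vec (Term L n) k → Vec Carrier k
    evals η []       = []
    evals η (t ∷ ts) = eval η t ∷ evals η ts

  infix 4 _⊨_

  _⊨_ : ∀ {n} → Vec Carrier n → Formula L n → Set
  η ⊨ ⊥′       = ⊥
  η ⊨ (s ≐ t)  = eval η s ≈ eval η t
  η ⊨ rel R ts = ⟦ R ⟧ʳ (evals η ts)
  η ⊨ (φ ∧′ ψ) = (η ⊨ φ) × (η ⊨ ψ)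
  η ⊨ (φ ∨′ ψ) = (η ⊨ φ) ⊎ (η ⊨ ψ)
  η ⊨ (φ ⇒′ ψ) = (η ⊨ φ) → (η ⊨ ψ)
  η ⊨ ∀′ φ     = ∀ x → (x ∷ η) ⊨ φ
  η ⊨ ∃′ φ     = ∃ λ x → (x ∷ η) ⊨ φ

  Th : Theory L
  Th σ = [] ⊨ σ

record _↪_ (L L′ : Language) : Set where
  field
    onFunction : ∀ {k} → Function L k → Function L′ k
    onRelation : ∀ {k} → Relation L k → Relation L′ k

module _ {L L′ : Language} (ι : L ↪ L′) where
  open _↪_ ι

  mutual
    translateTerm : ∀ {n} → Term L n → Term L′ n
    translateTerm (var x)    = var x
    translateTerm (app f ts) = app (onFunction f) (translateTerms ts)

    translateTerms : ∀ {n k} → Vec (Term L n) k → Vec (Term L′ n) k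
    translateTerms []       = []
    translateTerms (t ∷ ts) = translateTerm t ∷ translateTerms ts

  translate : ∀ {n} → Formula L n → Formula L′ n
  translate ⊥′         = ⊥′
  translate (s ≐ t)    = translateTerm s ≐ translateTerm t
  translate (rel R ts) = rel (onRelation R) (translateTerms ts)
  translate (φ ∧′ ψ)   = translate φ ∧′ translate ψ
  translate (φ ∨′ ψ)   = translate φ ∨′ translate ψ
  translate (φ ⇒′ ψ)   = translate φ ⇒′ translate ψ
  translate (∀′ φ)     = ∀′ (translate φ)
  translate (∃′ φ)     = ∃′ (translate φ)

  translateTheory : Theory L → Theory L′
  translateTheory T σ = ∃ λ τ → T τ × σ ≡ translate τ

------------------------------------------------------------------------
-- The languages and theories

data OrderRelation : ℕ → Set where
  lt : OrderRelation 2

-- The constructor `scale a` is the symbol f_a.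

data AddFunction (A : Set) : ℕ → Set where
  c0 c1      : AddFunction A 0
  scale      : A → AddFunction A 1
  plus minus : AddFunction A 2

data MultFunction (A : Set) : ℕ → Set where
  c0 c1     : MultFunction A 0
  scale     : A → MultFunction A 1
  times div : MultFunction A 2

data UnionFunction (A : Set) : ℕ → Set where
  c0 c1                : UnionFunction A 0
  scale                : A → UnionFunction A 1
  plus minus times div : UnionFunction A 2

AddLanguage MultLanguage UnionLanguage : Set → Language
AddLanguage   A = record { Function = AddFunction A
                         ; Relation = OrderRelation }
MultLanguage  A = record { Function = MultFunction A
                         ; Relation = OrderRelation }
UnionLanguage A = record { Function = UnionFunction A
                         ; Relation = OrderRelation }

add↪ : ∀ {A} → AddLanguage A ↪ UnionLanguage A
add↪ {A} = record { onFunction = f ; onRelation = λ R → R }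
  where
  f : ∀ {k} → AddFunction A k → UnionFunction A k
  f c0        = c0
  f c1        = c1
  f (scale a) = scale a
  f plus      = plus
  f minus     = minus

mult↪ : ∀ {A} → MultLanguage A ↪ UnionLanguage A
mult↪ {A} = record { onFunction = f ; onRelation = λ R → R }
  where
  f : ∀ {k} → MultFunction A k → UnionFunction A k
  f c0        = c0
  f c1        = c1
  f (scale a) = scale a
  f times     = times
  f div       = div

module _ {ℝ : CompleteOrderedField} (F : Subfield ℝ) where
  open CompleteOrderedField ℝ
  open Subfield F

  ⟦_⟧< : ∀ {k} → OrderRelation k → Vec Carrier k → Set
  ⟦ lt ⟧< (x ∷ y ∷ []) = x < y

  ℝ-add : RawStructure (AddLanguage Scalar)
  ℝ-add = record { Carrier = Carrier ; _≈_ = _≈_ ; ⟦_⟧ᶠ = ⟦_⟧ ; ⟦_⟧ʳ = ⟦_⟧< }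
    where
    ⟦_⟧ : ∀ {k} → AddFunction Scalar k → Vec Carrier k → Carrier
    ⟦ c0            ⟧ []           = 0#
    ⟦ c1            ⟧ []           = 1#
    ⟦ scale (a , _) ⟧ (x ∷ [])     = a * x
    ⟦ plus          ⟧ (x ∷ y ∷ []) = x + y
    ⟦ minus         ⟧ (x ∷ y ∷ []) = x - y

  ℝ-mult : RawStructure (MultLanguage Scalar)
  ℝ-mult = record { Carrier = Carrier ; _≈_ = _≈_ ; ⟦_⟧ᶠ = ⟦_⟧ ; ⟦_⟧ʳ = ⟦_⟧< }
    where
    ⟦_⟧ : ∀ {k} → MultFunction Scalar k → Vec Carrier k → Carrier
    ⟦ c0            ⟧ []           = 0#
    ⟦ c1            ⟧ []           = 1#
    ⟦ scale (a , _) ⟧ (x ∷ [])     = a * x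
    ⟦ times         ⟧ (x ∷ y ∷ []) = x * y
    ⟦ div           ⟧ (x ∷ y ∷ []) = x ÷ y

  T-add[_] : Theory (AddLanguage Scalar)
  T-add[_] = Th ℝ-add

  T-mult[_] : Theory (MultLanguage Scalar)
  T-mult[_] = Th ℝ-mult

  T[_] : Theory (UnionLanguage Scalar)
  T[_] = translateTheory add↪ T-add[_] ∪ translateTheory mult↪ T-mult[_]

  two : Scalar
  two = 1# + 1# , +-closed 1-closed 1-closed

module UnionSyntax {A : Set} {n : ℕ} where

  private
    Tm : Set
    Tm = Term (UnionLanguage A) n

  infixl 10 _⊗_
  infixl 9 _⊕_ _⊖_
  infix  8 _≼_ _≽_

  𝟘 𝟙 : Tm
  𝟘 = app c0 []
  𝟙 = app c1 []

  f[_] : A → Tm → Tm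
  f[ a ] t = app (scale a) (t ∷ [])

  const : A → Tm
  const a = f[ a ] 𝟙

  _⊕_ _⊖_ _⊗_ : Tm → Tm → Tm
  s ⊕ t = app plus (s ∷ t ∷ [])
  s ⊖ t = app minus (s ∷ t ∷ [])
  s ⊗ t = app times (s ∷ t ∷ [])

  -- The only relation symbol is <, so ≤ is an abbreviation.
  _≼_ _≽_ : Tm → Tm → Formula (UnionLanguage A) n
  s ≼ t = rel lt (s ∷ t ∷ []) ∨′ (s ≐ t)
  s ≽ t = t ≼ s

open UnionSyntax public

{-# OPTIONS --safe #-}
-- A derivation uses only finitely many axioms, so for the negative half it
-- suffices to find, for given finitely many true sentences, each additive or
-- multiplicative, a structure in which they hold and the inequality fails.
-- They remain true in some countable ordered field with an infinitesimal ε,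
-- and that field has an order automorphism σ that fixes 0 and 1 and commutes
-- with all standard scalings: σ x = c² / (2c - x) for x infinitely close to a
-- nonzero standard c, and σ x = x otherwise.  Keep the addition, and replace ×
-- and ÷ by their transports, as in x ⊗ y = σ⁻¹ (σ x × σ y).  The given
-- sentences still hold, but x ⊗ x < 2x - 1 for x = 1 ± ε, because
-- (1 ∓ ε)² > 1 ∓ 2ε.
--
-- For the positive half, a x ≤ x² is multiplicative for x ≥ a ≥ 0, and
-- 2x - 1 ≤ a x is additive for x ≤ 1 / (2 - a).  Finitely many intervals
-- [a , 1 / (2 - a)] lead from 1/2 up to r < 1, or from r > 1 up to 2, as the
-- step a ↦ 1 / (2 - a) lowers the reciprocal of a - 1 by one.

module Submission where

open import Defs
open import Level using (0ℓ) renaming (suc to lsuc)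
open import Axiom.ExcludedMiddle using (ExcludedMiddle)
open import Algebra.Bundles using (CommutativeRing)
import Algebra.Properties.AbelianGroup as AbelianGroupProperties
import Algebra.Properties.Ring as RingProperties
import Algebra.Properties.Semiring.Mult.TCOptimised as Multiples
import Algebra.Solver.Ring
open import Algebra.Solver.Ring.AlmostCommutativeRing
  using (fromCommutativeRing; _-Raw-AlmostCommutative⟶_)
open import Algebra.Structures using (IsCommutativeRing)
open import Data.Empty using (⊥; ⊥-elim)
open import Data.Fin using (#_)
open import Data.Fin.Base using (Fin; zero; suc)
open import Data.Fin.Substitution using (Sub; Lift; module VarSubst; module TermSubst)
open import Data.Integer.Base as ℤ using (ℤ; +_; -[1+_])
import Data.Integer.Properties as ℤ
open import Data.List.Base as List using (List; []; _∷_; _++_)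
open import Data.List.Membership.Propositional using (_∈_; mapWith∈)
open import Data.List.Membership.Propositional.Properties
  using (∈-++⁺ˡ; ∈-++⁺ʳ; ∈-map⁺; ∈-concat⁺′; ∈-cartesianProductWith⁺)
open import Data.List.Relation.Binary.Subset.Propositional using () renaming (_⊆_ to _⊆ˡ_)
open import Data.List.Relation.Unary.All as All using (All; []; _∷_)
import Data.List.Relation.Unary.All.Properties as All
open import Data.List.Relation.Unary.Any using (here; there)
import Data.Maybe.Base as Maybe
open import Data.Nat.Base as ℕ using (ℕ; zero; suc)
import Data.Nat.Properties as ℕ
open import Data.Product.Base as Product using (∃; _×_; _,_; proj₁; proj₂)
open import Data.Sum.Base as Sum using (_⊎_; inj₁; inj₂)
open import Data.Unit.Base using (⊤; tt)
open import Data.Vec.Base as Vec using (Vec; []; _∷_)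
import Data.Vec.Properties as Vec
open import Data.Vec.Relation.Binary.Pointwise.Inductive as Pointwise using (Pointwise; []; _∷_)
open import Data.Vec.Relation.Unary.All as VecAll using ([]; _∷_)
open import Function.Base using (_∘_)
open import Function.Bundles using (_⇔_; mk⇔; Equivalence)
open import Function.Construct.Identity using (⇔-id)
open import Relation.Binary.Core using (Rel)
open import Relation.Binary.Definitions
  using (Trichotomous; Tri; tri<; tri≈; tri>; _Respects_)
open import Relation.Binary.PropositionalEquality as ≡ using (_≡_)
import Relation.Binary.Construct.StrictToNonStrict as StrictToNonStrict
import Relation.Binary.Reasoning.Setoid as SetoidReasoning
open import Relation.Binary.Structures using (IsEquivalence; IsStrictTotalOrder)
open import Relation.Nullary using (¬_; yes; no)
open import Relation.Nullary.Decidable using (decidable-stable; dec⇒maybe; toSum)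
open import Relation.Unary using (Pred; _∩_; ∁; _⊆_)

open Equivalence using (to; from)

-- Ordered fields and a ring solver with integer coefficients

-- The two theories interact only through 0, 1, < and the scalings, so any automorphism of this
-- common reduct may be used to detach multiplication from addition. Over the reals it would be the
-- identity: it fixes F pointwise, and F is dense. Infinitesimals are what leaves room for another
-- one. The map c² / (2c - x) is composed of x ↦ 2c - x and y ↦ c² / y, which both reverse the order
-- near c, so it is increasing there. It is homogeneous of degree one in c and x, so scaling by a
-- carries the map near c to the map near ac. It agrees with the identity to first order only, and
-- 2x - 1 and x² differ at 1 ± ε just to second order. Countability lets the extension be built set
-- by set: finitely many sentences have finitely many Skolem functions, so only countably many
-- functions are named. The positive half is non-uniform as well: the number of intervals is bounded
-- in terms of 1 / |r - 1|, which is finite by the Archimedean property but grows without bound as r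
-- tends to 1.

record OrderedField : Set (lsuc 0ℓ) where
  infix 4 _<_
  field
    commutativeRing : CommutativeRing 0ℓ 0ℓ

  open CommutativeRing commutativeRing public

  field
    _<_                : Rel Carrier 0ℓ
    isStrictTotalOrder : IsStrictTotalOrder _≈_ _<_
    0<1                : 0# < 1#
    inverse            : ∀ x → ¬ x ≈ 0# → ∃ λ y → x * y ≈ 1#
    +-mono-<           : ∀ {x y} z → x < y → x + z < y + z
    *-pos              : ∀ {x y} → 0# < x → 0# < y → 0# < x * y

  open IsStrictTotalOrder isStrictTotalOrder public
    using (compare; _≟_)
    renaming (trans to <-trans; <-respʳ-≈ to <-respʳ; <-respˡ-≈ to <-respˡ
             ; irrefl to <-irrefl)
  open StrictToNonStrict _≈_ _<_ public using (_≤_)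

orderedField : CompleteOrderedField → OrderedField
orderedField ℝ = record
  { commutativeRing    = commutativeRing
  ; isStrictTotalOrder = isStrictTotalOrder
  ; 0<1                = 0<1
  ; inverse            = inverse
  ; +-mono-<           = +-mono-<
  ; *-pos              = *-pos
  }
  where open CompleteOrderedField ℝ

-- Equality of integers computes, so normal forms cancel. The multiples are the optimised ones
-- because then `con (+ 2)` evaluates to `1# + 1#` on the nose.
module IntegerCoefficientSolver (R : CommutativeRing 0ℓ 0ℓ) where
  open CommutativeRing R
  open RingProperties ring
  open AbelianGroupProperties +-abelianGroup using (⁻¹-∙-comm)
  open Multiples semiring using (×-homo-+; ×1-homo-*; 1+×) renaming (_×_ to _·_)
  open SetoidReasoning setoid

  fromℤ : ℤ → Carrier
  fromℤ (+ n)      = n · 1#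
  fromℤ (-[1+ n ]) = - (suc n · 1#)

  private
    ⊖-homo : ∀ m n → fromℤ (m ℤ.⊖ n) ≈ m · 1# - n · 1#
    ⊖-homo m       zero    = begin
      m · 1#         ≈⟨ +-identityʳ _ ⟨
      m · 1# + 0#    ≈⟨ +-congˡ -0#≈0# ⟨
      m · 1# - 0#    ∎
    ⊖-homo zero    (suc n) = sym (+-identityˡ _)
    ⊖-homo (suc m) (suc n) = begin
      fromℤ (suc m ℤ.⊖ suc n)                   ≡⟨ ≡.cong fromℤ (ℤ.[1+m]⊖[1+n]≡m⊖n m n) ⟩
      fromℤ (m ℤ.⊖ n)                           ≈⟨ ⊖-homo m n ⟩
      m · 1# - n · 1#                           ≈⟨ +-congʳ (+-identityʳ _) ⟨
      m · 1# + 0# - n · 1#                      ≈⟨ +-congʳ (+-congˡ (-‿inverseʳ 1#)) ⟨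
      m · 1# + (1# - 1#) - n · 1#               ≈⟨ +-congʳ (+-assoc _ _ _) ⟨
      m · 1# + 1# - 1# - n · 1#                 ≈⟨ +-assoc _ _ _ ⟩
      m · 1# + 1# + (- 1# - n · 1#)             ≈⟨ +-cong (trans (+-comm _ _) (sym (1+× m 1#)))
                                                          (trans (⁻¹-∙-comm _ _) (-‿cong (sym (1+× n 1#)))) ⟩
      suc m · 1# - suc n · 1#                   ∎

    +-homo : ∀ i j → fromℤ (i ℤ.+ j) ≈ fromℤ i + fromℤ j
    +-homo (+ m)      (+ n)      = ×-homo-+ 1# m n
    +-homo (+ m)      (-[1+ n ]) = ⊖-homo m (suc n)
    +-homo (-[1+ m ]) (+ n)      = trans (⊖-homo n (suc m)) (+-comm _ _)
    +-homo (-[1+ m ]) (-[1+ n ]) = begin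
      - (suc (suc (m ℕ.+ n)) · 1#)        ≡⟨ ≡.cong (λ k → - (k · 1#)) (ℕ.+-suc (suc m) n) ⟨
      - ((suc m ℕ.+ suc n) · 1#)          ≈⟨ -‿cong (×-homo-+ 1# (suc m) (suc n)) ⟩
      - (suc m · 1# + suc n · 1#)         ≈⟨ ⁻¹-∙-comm _ _ ⟨
      - (suc m · 1#) - suc n · 1#         ∎

    -‿homo : ∀ i → fromℤ (ℤ.- i) ≈ - fromℤ i
    -‿homo (+ zero)   = sym -0#≈0#
    -‿homo (+ suc n)  = refl
    -‿homo (-[1+ n ]) = sym (-‿involutive _)

    *-homo⁺ : ∀ m j → fromℤ (+ m ℤ.* j) ≈ m · 1# * fromℤ j
    *-homo⁺ m (+ n)      = begin
      fromℤ (+ m ℤ.* + n)     ≡⟨ ≡.cong fromℤ (ℤ.pos-* m n) ⟨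
      (m ℕ.* n) · 1#          ≈⟨ ×1-homo-* m n ⟩
      m · 1# * (n · 1#)       ∎
    *-homo⁺ m (-[1+ n ]) = begin
      fromℤ (+ m ℤ.* ℤ.- (+ suc n))   ≡⟨ ≡.cong fromℤ (ℤ.neg-distribʳ-* (+ m) (+ suc n)) ⟨
      fromℤ (ℤ.- (+ m ℤ.* + suc n))   ≈⟨ -‿homo (+ m ℤ.* + suc n) ⟩
      - fromℤ (+ m ℤ.* + suc n)       ≈⟨ -‿cong (*-homo⁺ m (+ suc n)) ⟩
      - (m · 1# * (suc n · 1#))       ≈⟨ -‿distribʳ-* _ _ ⟩
      m · 1# * - (suc n · 1#)         ∎

    *-homo : ∀ i j → fromℤ (i ℤ.* j) ≈ fromℤ i * fromℤ j
    *-homo (+ m)      j = *-homo⁺ m j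
    *-homo (-[1+ m ]) j = begin
      fromℤ (ℤ.- (+ suc m) ℤ.* j)     ≡⟨ ≡.cong fromℤ (ℤ.neg-distribˡ-* (+ suc m) j) ⟨
      fromℤ (ℤ.- (+ suc m ℤ.* j))     ≈⟨ -‿homo (+ suc m ℤ.* j) ⟩
      - fromℤ (+ suc m ℤ.* j)         ≈⟨ -‿cong (*-homo⁺ (suc m) j) ⟩
      - (suc m · 1# * fromℤ j)        ≈⟨ -‿distribˡ-* _ _ ⟩
      - (suc m · 1#) * fromℤ j        ∎

    ℤ⟶R : CommutativeRing.rawRing ℤ.+-*-commutativeRing
          -Raw-AlmostCommutative⟶ fromCommutativeRing R
    ℤ⟶R = record
      { ⟦_⟧    = fromℤ
      ; +-homo = +-homo
      ; *-homo = *-homo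
      ; -‿homo = -‿homo
      ; 0-homo = refl
      ; 1-homo = refl
      }

  open Algebra.Solver.Ring
    (CommutativeRing.rawRing ℤ.+-*-commutativeRing) (fromCommutativeRing R) ℤ⟶R
    (λ i j → Maybe.map (λ i≡j → reflexive (≡.cong fromℤ i≡j)) (dec⇒maybe (i ℤ.≟ j)))
    public using (solve; _:=_; _:+_; _:*_; _:-_; :-_; con)

module OrderedFieldProperties (K : OrderedField) where
  open OrderedField K
  open IntegerCoefficientSolver commutativeRing public

  -- Brings a hypothesis `u ≈ v` within reach of the ring solver: the solver proves an identity with
  -- a correction term `k * (u - v)`, which is then dropped.
  absorb : ∀ {b u v} k → u ≈ v → b + k * (u - v) ≈ b
  absorb {b} {u} {v} k u≈v = begin
    b + k * (u - v)   ≈⟨ +-congˡ (*-congˡ (+-congʳ u≈v)) ⟩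
    b + k * (v - v)   ≈⟨ solve 3 (λ b k v → b :+ k :* (v :- v) := b) refl b k v ⟩
    b                 ∎
    where open import Relation.Binary.Reasoning.Setoid setoid

  positive-difference : ∀ {x y} → x < y → 0# < y - x
  positive-difference {x} x<y = <-respˡ (-‿inverseʳ x) (+-mono-< (- x) x<y)

  -- Together with `absorb` this reduces the order arguments below to polynomial identities whose
  -- one side is visibly positive.
  certify : ∀ {p x y} → 0# < p → p ≈ y - x → x < y
  certify {p} {x} {y} 0<p p≈y-x =
    <-respʳ (trans (+-congʳ p≈y-x) (solve 2 (λ x y → y :- x :+ x := y) refl x y))
      (<-respˡ (+-identityˡ x) (+-mono-< x 0<p))

  +-pos : ∀ {x y} → 0# < x → 0# < y → 0# < x + y
  +-pos {x} {y} 0<x 0<y =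
    <-trans 0<y (<-respˡ (+-identityˡ y) (+-mono-< y 0<x))

  +-pos-nonneg : ∀ {x y} → 0# < x → 0# ≤ y → 0# < x + y
  +-pos-nonneg         0<x (inj₁ 0<y) = +-pos 0<x 0<y
  +-pos-nonneg {x} {y} 0<x (inj₂ 0≈y) = <-respʳ (trans (sym (+-identityʳ x)) (+-congˡ 0≈y)) 0<x

  <⇒≉ : ∀ {x} → 0# < x → ¬ x ≈ 0#
  <⇒≉ 0<x x≈0 = <-irrefl (sym x≈0) 0<x

  0<2 : 0# < 1# + 1#
  0<2 = +-pos 0<1 0<1

  neg-pos : ∀ {x} → x < 0# → 0# < - x
  neg-pos x<0 = <-respʳ (+-identityˡ _) (positive-difference x<0)

  square-pos : ∀ {x} → ¬ x ≈ 0# → 0# < x * x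
  square-pos {x} x≉0 with compare x 0#
  ... | tri< x<0 _ _ = <-respʳ (solve 1 (λ x → (:- x) :* (:- x) := x :* x) refl x)
                         (*-pos (neg-pos x<0) (neg-pos x<0))
  ... | tri≈ _ x≈0 _ = ⊥-elim (x≉0 x≈0)
  ... | tri> _ _ 0<x = *-pos 0<x 0<x

  square-nonneg : ∀ x → 0# ≤ x * x
  square-nonneg x with x ≟ 0#
  ... | yes x≈0 = inj₂ (sym (trans (*-congʳ x≈0) (zeroˡ x)))
  ... | no  x≉0 = inj₁ (square-pos x≉0)

  double-nonneg : ∀ {x} → 0# ≤ x → 0# ≤ x + x
  double-nonneg (inj₁ 0<x) = inj₁ (+-pos 0<x 0<x)
  double-nonneg (inj₂ 0≈x) = inj₂ (trans 0≈x (trans (sym (+-identityʳ _)) (+-congˡ 0≈x)))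

  1≉0 : ¬ 1# ≈ 0#
  1≉0 = <⇒≉ 0<1

  factor-≉ : ∀ {x y} → ¬ x * y ≈ 0# → ¬ x ≈ 0#
  factor-≉ {y = y} xy≉0 x≈0 = xy≉0 (trans (*-congʳ x≈0) (zeroˡ y))

  invertible-≉ : ∀ {x y} → x * y ≈ 1# → ¬ x ≈ 0#
  invertible-≉ xy≈1 = factor-≉ (λ xy≈0 → 1≉0 (trans (sym xy≈1) xy≈0))

  *-cancelˡ : ∀ {p x y} → ¬ p ≈ 0# → p * x ≈ p * y → x ≈ y
  *-cancelˡ {p} {x} {y} p≉0 px≈py with inverse p p≉0
  ... | w , pw≈1 = trans (unit x) (trans (*-congˡ px≈py) (sym (unit y)))
    where
    unit : ∀ z → z ≈ w * (p * z)
    unit z = trans (sym (absorb z pw≈1))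
      (solve 3 (λ z p w → z :+ z :* (p :* w :- con (+ 1)) := w :* (p :* z)) refl z p w)

  *-≉ : ∀ {x y} → ¬ x ≈ 0# → ¬ y ≈ 0# → ¬ x * y ≈ 0#
  *-≉ {x} x≉0 y≉0 xy≈0 = y≉0 (*-cancelˡ x≉0 (trans xy≈0 (sym (zeroʳ x))))

  pos-cancelˡ : ∀ {p x} → 0# < p → 0# < p * x → 0# < x
  pos-cancelˡ {p} {x} 0<p 0<px with compare x 0#
  ... | tri> _ _ 0<x = 0<x
  ... | tri≈ _ x≈0 _ = ⊥-elim (<-irrefl (sym (trans (*-congˡ x≈0) (zeroʳ p))) 0<px)
  ... | tri< x<0 _ _ = ⊥-elim (<-irrefl
          (solve 2 (λ p x → con (+ 0) := p :* x :+ p :* (:- x)) refl p x)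
          (+-pos 0<px (*-pos 0<p (neg-pos x<0))))

  -- Failure of the inequality at 1 + e, with z for the transported square. The factor b is separate
  -- because the element that interprets the scalar 2 is only equal to 2, not identical with it.
  double-negative : ∀ {z e b} → z < 1# + (e + e) → b ≈ 1# + 1# → ¬ 0# ≤ z - b * (1# + e) + 1#
  double-negative {z} {e} {b} z< b≈2 0≤u = <-irrefl
    (trans (sym (absorb (- (1# + e)) b≈2)) (solve 3 (λ z e b →
      con (+ 0) :+ (:- (con (+ 1) :+ e)) :* (b :- con (+ 2)) :=
      (con (+ 1) :+ (e :+ e)) :- z :+ (z :- b :* (con (+ 1) :+ e) :+ con (+ 1))) refl z e b) )
    (+-pos-nonneg (positive-difference z<) 0≤u)

record IsSubfield (K : OrderedField) (C : Pred (OrderedField.Carrier K) 0ℓ) : Set where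
  open OrderedField K
  field
    1-closed   : C 1#
    +-closed   : ∀ {x y} → C x → C y → C (x + y)
    neg-closed : ∀ {x} → C x → C (- x)
    *-closed   : ∀ {x y} → C x → C y → C (x * y)
    inv-closed : ∀ {x y} → C x → x * y ≈ 1# → C y

-- Monads of standard elements and the order automorphism

module MonadAutomorphism (em : ExcludedMiddle 0ℓ) (K : OrderedField)
  (C : Pred (OrderedField.Carrier K) 0ℓ) (C-subfield : IsSubfield K C) where
  open OrderedField K
  open OrderedFieldProperties K
  open IsSubfield C-subfield

  -- This is |e| < |d|, written with squares to avoid absolute values and to feed polynomial
  -- certificates.
  Infinitesimal : Pred Carrier 0ℓ
  Infinitesimal e = ∀ {d} → C d → ¬ d ≈ 0# → e * e < d * d

  infinitesimal-resp : Infinitesimal Respects _≈_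
  infinitesimal-resp e≈e′ inf-e d∈C d≉0 = <-respˡ (*-cong e≈e′ e≈e′) (inf-e d∈C d≉0)

  infinitesimal-neg : ∀ {e} → Infinitesimal e → Infinitesimal (- e)
  infinitesimal-neg {e} inf-e d∈C d≉0 =
    <-respˡ (solve 1 (λ e → e :* e := (:- e) :* (:- e)) refl e) (inf-e d∈C d≉0)

  infinitesimal-0 : ∀ {e} → e ≈ 0# → Infinitesimal e
  infinitesimal-0 {e} e≈0 _ d≉0 = <-respˡ (sym (trans (*-congʳ e≈0) (zeroˡ e))) (square-pos d≉0)

  infinitesimal-scale : ∀ {b e} → C b → ¬ b ≈ 0# → Infinitesimal e → Infinitesimal (b * e)
  infinitesimal-scale {b} {e} b∈C b≉0 inf-e {d} d∈C d≉0 with inverse b b≉0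
  ... | w , bw≈1 = certify
    (*-pos (square-pos b≉0)
      (positive-difference (inf-e (*-closed d∈C (inv-closed b∈C bw≈1)) (*-≉ d≉0 w≉0))))
    (trans (solve 4 (λ b e d w →
       b :* b :* (d :* w :* (d :* w) :- e :* e) :=
       d :* d :- b :* e :* (b :* e) :+ d :* d :* (b :* w :+ con (+ 1)) :* (b :* w :- con (+ 1))) refl b e d w)
     (absorb _ bw≈1))
    where
    w≉0 : ¬ w ≈ 0#
    w≉0 = invertible-≉ (trans (*-comm w b) bw≈1)

  two∈C : C (1# + 1#)
  two∈C = +-closed 1-closed 1-closed

  infinitesimal-double : ∀ {e} → Infinitesimal e → Infinitesimal ((1# + 1#) * e)
  infinitesimal-double = infinitesimal-scale two∈C (<⇒≉ 0<2)

  Near : Carrier → Pred Carrier 0ℓ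
  Near c x = Infinitesimal (x - c)

  near-resp : ∀ {c c′ x x′} → c ≈ c′ → x ≈ x′ → Near c x → Near c′ x′
  near-resp c≈c′ x≈x′ = infinitesimal-resp (+-cong x≈x′ (-‿cong c≈c′))

  reflect : ∀ {c x} → Near c x → Near c (c + c - x)
  reflect {c} {x} x∼c = infinitesimal-resp
    (solve 2 (λ c x → :- (x :- c) := c :+ c :- x :- c) refl c x) (infinitesimal-neg x∼c)

  near-same-sign : ∀ {c x} → C c → ¬ c ≈ 0# → Near c x → 0# < x * c
  near-same-sign {c} {x} c∈C c≉0 x∼c = pos-cancelˡ 0<2
    (<-respʳ (solve 2 (λ c x → c :* c :- (x :- c) :* (x :- c) :+ x :* x := con (+ 2) :* (x :* c)) refl c x)
      (+-pos-nonneg (positive-difference (x∼c c∈C c≉0)) (square-nonneg x)))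

  near-≉ : ∀ {c x} → C c → ¬ c ≈ 0# → Near c x → ¬ x ≈ 0#
  near-≉ c∈C c≉0 x∼c = factor-≉ (<⇒≉ (near-same-sign c∈C c≉0 x∼c))

  -- By the parallelogram law, u² + v² = 2d² + 2s² for the doubled distances u and v of z from the
  -- two centres. If d = c - c′ were nonzero, u² and v² would both be smaller than d².
  near-unique : ∀ {c c′ z} → C c → C c′ → Near c z → Near c′ z → c ≈ c′
  near-unique {c} {c′} {z} c∈C c′∈C z∼c z∼c′ with c ≟ c′
  ... | yes c≈c′ = c≈c′
  ... | no  c≉c′ = ⊥-elim (<-irrefl refl
    (<-respʳ (solve 3 (λ c c′ z →
        let d = c :- c′; u = con (+ 2) :* (z :- c); v = con (+ 2) :* (z :- c′); s = z :- c :+ (z :- c′) in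
        d :* d :- u :* u :+ (d :* d :- v :* v) :+ (s :* s :+ s :* s) := con (+ 0)) refl c c′ z)
      (+-pos-nonneg
        (+-pos (positive-difference (infinitesimal-double z∼c d∈C d≉0))
               (positive-difference (infinitesimal-double z∼c′ d∈C d≉0)))
        (double-nonneg (square-nonneg _)))))
    where
    d∈C : C (c - c′)
    d∈C = +-closed c∈C (neg-closed c′∈C)
    d≉0 : ¬ c - c′ ≈ 0#
    d≉0 c-c′≈0 = c≉c′ (trans (solve 2 (λ c c′ → c := c′ :+ con (+ 1) :* (c :- c′ :- con (+ 0))) refl c c′)
      (absorb 1# c-c′≈0))

  near-convex : ∀ {c x y z} → Near c x → Near c z → x < y → y < z → Near c y
  near-convex {c} {x} {y} {z} x∼c z∼c x<y y<z d∈C d≉0 with compare y c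
  ... | tri< y<c _ _ = <-trans (certify
          (*-pos 0<y-x (+-pos (+-pos 0<c-y 0<y-x) 0<c-y))
          (solve 3 (λ c x y → (y :- x) :* (c :- y :+ (y :- x) :+ (c :- y))
             := (x :- c) :* (x :- c) :- (y :- c) :* (y :- c)) refl c x y))
          (x∼c d∈C d≉0)
    where
    0<y-x = positive-difference x<y
    0<c-y = positive-difference y<c
  ... | tri≈ _ y≈c _ =
          infinitesimal-0 (trans (+-congʳ y≈c) (-‿inverseʳ c)) d∈C d≉0
  ... | tri> _ _ c<y = <-trans (certify
          (*-pos 0<z-y (+-pos (+-pos 0<y-c 0<z-y) 0<y-c))
          (solve 3 (λ c z y → (z :- y) :* (y :- c :+ (z :- y) :+ (y :- c))
             := (z :- c) :* (z :- c) :- (y :- c) :* (y :- c)) refl c z y))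
          (z∼c d∈C d≉0)
    where
    0<z-y = positive-difference y<z
    0<y-c = positive-difference c<y

  -- The automorphism as a relation: a centre is unique only up to `≈`, and the multiplied-out
  -- equation for s = c² / (2c - x) spares a division. Infinitesimals lie near no nonzero centre and
  -- so stay fixed.
  data Graph (x s : Carrier) : Set where
    inside  : ∀ c → C c → ¬ c ≈ 0# → Near c x → (c + c - x) * s ≈ c * c → Graph x s
    outside : (∀ c → C c → ¬ c ≈ 0# → ¬ Near c x) → x ≈ s → Graph x s

  -- With p = 2c - x, the equation gives p (s - c) = c (x - c). Since 4p² > c², s is less than twice
  -- as far from c as x is, if x differs from c.
  image-near : ∀ {c x s} → C c → ¬ c ≈ 0# → Near c x → (c + c - x) * s ≈ c * c → Near c s
  image-near {c} {x} {s} c∈C c≉0 x∼c ps≈c² {d} d∈C d≉0 = certify (pos-cancelˡ 0<4p²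
    (<-respʳ (trans
        (solve 4 (λ c x s d →
          let p = c :+ c :- x; e = x :- c; q = con (+ 2) :* e; four = con (+ 4) in
          d :* d :* (four :* (p :* p) :- c :* c) :+ c :* c :* (d :* d :- q :* q) :=
          four :* (p :* p) :* (d :* d :- (s :- c) :* (s :- c))
          :+ four :* (p :* s :+ c :* c :- p :* c :- p :* c) :* (p :* s :- c :* c)) refl c x s d)
        (absorb _ ps≈c²))
      (+-pos (*-pos (square-pos d≉0) 0<4p²-c²)
             (*-pos (square-pos c≉0) (positive-difference (infinitesimal-double x∼c d∈C d≉0))))))
    refl
    where
    p four : Carrier
    p = c + c - x
    four = 1# + 1# + 1# + 1#
    0<4p²-c² : 0# < four * (p * p) - c * c
    0<4p²-c² = <-respʳ
      (solve 2 (λ c x →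
         let p = c :+ c :- x; q = con (+ 2) :* (x :- c) in
         c :* c :- q :* q :+ ((q :- c) :* (q :- c) :+ (q :- c) :* (q :- c))
         := con (+ 4) :* (p :* p) :- c :* c) refl c x)
      (+-pos-nonneg (positive-difference (infinitesimal-double x∼c c∈C c≉0)) (double-nonneg (square-nonneg _)))
    0<4p² : 0# < four * (p * p)
    0<4p² = *-pos (+-pos (+-pos 0<2 0<1) 0<1) (square-pos (near-≉ c∈C c≉0 (reflect x∼c)))

  graph-total : ∀ x → ∃ λ s → Graph x s
  graph-total x with em {∃ λ c → C c × ¬ c ≈ 0# × Near c x}
  ... | no  ¬near = x , outside (λ c c∈C c≉0 x∼c → ¬near (c , c∈C , c≉0 , x∼c)) refl
  ... | yes (c , c∈C , c≉0 , x∼c) with inverse (c + c - x) (near-≉ c∈C c≉0 (reflect x∼c))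
  ...   | w , pw≈1 = w * (c * c) , inside c c∈C c≉0 x∼c
          (trans (sym (*-assoc _ _ _)) (trans (*-congʳ pw≈1) (*-identityˡ _)))

  -- The preimage 2c - c² / s arises by reflecting s in c, applying the map, and reflecting back: c²
  -- / s is the image of 2c - s, so `image-near` and `reflect` place the preimage near c.
  graph-onto : ∀ s → ∃ λ x → Graph x s
  graph-onto s with em {∃ λ c → C c × ¬ c ≈ 0# × Near c s}
  ... | no  ¬near = s , outside (λ c c∈C c≉0 s∼c → ¬near (c , c∈C , c≉0 , s∼c)) refl
  ... | yes (c , c∈C , c≉0 , s∼c) with inverse s (near-≉ c∈C c≉0 s∼c)
  ...   | w , sw≈1 = c + c - s′ , inside c c∈C c≉0 (reflect (image-near c∈C c≉0 (reflect s∼c) ps′≈c²))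
          (trans (solve 3 (λ c s w → (c :+ c :- (c :+ c :- w :* (c :* c))) :* s
                    := c :* c :+ c :* c :* (s :* w :- con (+ 1))) refl c s w)
                 (absorb _ sw≈1))
    where
    s′ : Carrier
    s′ = w * (c * c)
    ps′≈c² : (c + c - (c + c - s)) * s′ ≈ c * c
    ps′≈c² = trans (solve 3 (λ c s w → (c :+ c :- (c :+ c :- s)) :* (w :* (c :* c))
                      := c :* c :+ c :* c :* (s :* w :- con (+ 1))) refl c s w)
                   (absorb _ sw≈1)

  private
    Convex : Pred Carrier 0ℓ → Set
    Convex A = ∀ {x y z} → A x → A z → x < y → y < z → A y

    -- Every point stays in its own monad, so order between different monads is kept by convexity
    -- alone. A point outside all monads counts as the convex class of elements equal to it.
    disjoint-convex-mono : ∀ {A B : Pred Carrier 0ℓ} → Convex A → Convex B →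
      A Respects _≈_ → B Respects _≈_ → (∀ {z} → A z → ¬ B z) →
      ∀ {x s y t} → A x → A s → B y → B t → x < y → s < t
    disjoint-convex-mono A-convex B-convex A-resp B-resp disjoint {x} {s} {y} {t} x∈A s∈A y∈B t∈B x<y
      with compare s t
    ... | tri< s<t _ _ = s<t
    ... | tri≈ _ s≈t _ = ⊥-elim (disjoint (A-resp s≈t s∈A) t∈B)
    ... | tri> _ _ t<s with compare x t
    ...   | tri< x<t _ _ = ⊥-elim (disjoint (A-convex x∈A s∈A x<t t<s) t∈B)
    ...   | tri≈ _ x≈t _ = ⊥-elim (disjoint (A-resp x≈t x∈A) t∈B)
    ...   | tri> _ _ t<x = ⊥-elim (disjoint x∈A (B-convex t∈B y∈B t<x x<y))

    point-convex : ∀ {u} → Convex (u ≈_)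
    point-convex u≈x u≈z x<y y<z = ⊥-elim (<-irrefl (trans (sym u≈x) u≈z) (<-trans x<y y<z))

    -- With p = 2c - x and q = 2c - y, t - s = c² (y - x) / (p q). Multiplying p and q each by c
    -- makes both factors positive whatever the sign of c.
    monad-mono : ∀ {c x y s t} → C c → ¬ c ≈ 0# → Near c x → Near c y →
      (c + c - x) * s ≈ c * c → (c + c - y) * t ≈ c * c → x < y → s < t
    monad-mono {c} {x} {y} {s} {t} c∈C c≉0 x∼c y∼c ps≈c² qt≈c² x<y = certify (pos-cancelˡ
      0<pqc²
      (<-respʳ (trans (solve 5 (λ c x y s t →
          let p = c :+ c :- x; q = c :+ c :- y; c² = c :* c in
          c² :* c² :* (y :- x) :=
          (p :* c) :* (q :* c) :* (t :- s) :+ c² :* q :* (p :* s :- c²)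
            :+ (:- (c² :* p)) :* (q :* t :- c²)) refl c x y s t)
        (trans (absorb _ qt≈c²) (absorb _ ps≈c²)))
      (*-pos (*-pos (square-pos c≉0) (square-pos c≉0)) (positive-difference x<y))))
      refl
      where
      0<pqc² : 0# < ((c + c - x) * c) * ((c + c - y) * c)
      0<pqc² = *-pos (near-same-sign c∈C c≉0 (reflect x∼c)) (near-same-sign c∈C c≉0 (reflect y∼c))

    change-centre : ∀ {c c′ x s} → c ≈ c′ → (c + c - x) * s ≈ c * c → (c′ + c′ - x) * s ≈ c′ * c′
    change-centre c≈c′ eq = trans (*-congʳ (+-congʳ (+-cong (sym c≈c′) (sym c≈c′)))) (trans eq (*-cong c≈c′ c≈c′))

  graph-mono : ∀ {x s y t} → Graph x s → Graph y t → x < y → s < t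
  graph-mono (inside c c∈C c≉0 x∼c eq) (inside c′ c′∈C c′≉0 y∼c′ eq′) x<y with c ≟ c′
  ... | yes c≈c′ = monad-mono c∈C c≉0 x∼c (near-resp (sym c≈c′) refl y∼c′) eq
          (change-centre (sym c≈c′) eq′) x<y
  ... | no  c≉c′ = disjoint-convex-mono near-convex near-convex (near-resp refl) (near-resp refl)
          (λ z∼c z∼c′ → c≉c′ (near-unique c∈C c′∈C z∼c z∼c′))
          x∼c (image-near c∈C c≉0 x∼c eq) y∼c′ (image-near c′∈C c′≉0 y∼c′ eq′) x<y
  graph-mono (inside c c∈C c≉0 x∼c eq) (outside y-out y≈t) =
    disjoint-convex-mono near-convex point-convex (near-resp refl) (λ z≈z′ y≈z → trans y≈z z≈z′)
      (λ z∼c y≈z → y-out c c∈C c≉0 (near-resp refl (sym y≈z) z∼c))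
      x∼c (image-near c∈C c≉0 x∼c eq) refl y≈t
  graph-mono (outside x-out x≈s) (inside c c∈C c≉0 y∼c eq) =
    disjoint-convex-mono point-convex near-convex (λ z≈z′ x≈z → trans x≈z z≈z′) (near-resp refl)
      (λ x≈z z∼c → x-out c c∈C c≉0 (near-resp refl (sym x≈z) z∼c))
      refl x≈s y∼c (image-near c∈C c≉0 y∼c eq)
  graph-mono (outside _ x≈s) (outside _ y≈t) x<y = <-respʳ y≈t (<-respˡ x≈s x<y)

  graph-cong : ∀ {x s y t} → Graph x s → Graph y t → x ≈ y → s ≈ t
  graph-cong {y = y} (inside c c∈C c≉0 x∼c eq) (inside c′ c′∈C c′≉0 y∼c′ eq′) x≈y =
    *-cancelˡ (near-≉ c∈C c≉0 (reflect x∼c))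
      (trans eq (trans (sym (change-centre (near-unique c′∈C c∈C y∼c′ (near-resp refl x≈y x∼c)) eq′))
                       (*-congʳ (+-congˡ (-‿cong (sym x≈y))))))
  graph-cong (inside c c∈C c≉0 x∼c _) (outside y-out _) x≈y =
    ⊥-elim (y-out c c∈C c≉0 (near-resp refl x≈y x∼c))
  graph-cong (outside x-out _) (inside c c∈C c≉0 y∼c _) x≈y =
    ⊥-elim (x-out c c∈C c≉0 (near-resp refl (sym x≈y) y∼c))
  graph-cong (outside _ x≈s) (outside _ y≈t) x≈y = trans (sym x≈s) (trans x≈y y≈t)

  graph-reflects-< : ∀ {x s y t} → Graph x s → Graph y t → s < t → x < y
  graph-reflects-< {x} {y = y} gx gy s<t with compare x y
  ... | tri< x<y _ _ = x<y
  ... | tri≈ _ x≈y _ = ⊥-elim (<-irrefl (graph-cong gx gy x≈y) s<t)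
  ... | tri> _ _ y<x = ⊥-elim (<-irrefl refl (<-trans s<t (graph-mono gy gx y<x)))

  graph-reflects-≈ : ∀ {x s y t} → Graph x s → Graph y t → s ≈ t → x ≈ y
  graph-reflects-≈ {x} {y = y} gx gy s≈t with compare x y
  ... | tri< x<y _ _ = ⊥-elim (<-irrefl s≈t (graph-mono gx gy x<y))
  ... | tri≈ _ x≈y _ = x≈y
  ... | tri> _ _ y<x = ⊥-elim (<-irrefl (sym s≈t) (graph-mono gy gx y<x))

  graph-0 : Graph 0# 0#
  graph-0 = outside (λ c c∈C c≉0 0∼c → near-≉ c∈C c≉0 0∼c refl) refl

  graph-near-1 : ∀ {e s} → Infinitesimal e → (1# - e) * s ≈ 1# → Graph (1# + e) s
  graph-near-1 {e} {s} inf-e eq = inside 1# 1-closed 1≉0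
    (infinitesimal-resp (solve 1 (λ e → e := con (+ 1) :+ e :- con (+ 1)) refl e) inf-e)
    (trans (solve 2 (λ e s → (con (+ 2) :- (con (+ 1) :+ e)) :* s := (con (+ 1) :- e) :* s) refl e s)
      (trans eq (sym (*-identityˡ 1#))))

  graph-1 : Graph 1# 1#
  graph-1 = inside 1# 1-closed 1≉0 (infinitesimal-0 (-‿inverseʳ 1#))
    (solve 0 ((con (+ 2) :- con (+ 1)) :* con (+ 1) := con (+ 1) :* con (+ 1)) refl)

  -- Homogeneity of c² / (2c - x): for nonzero a, scaling moves the monad of c onto that of a c.
  -- This is why the monads of all nonzero standard elements are moved, and not just that of 1.
  graph-scale : ∀ {a x s} → C a → Graph x s → Graph (a * x) (a * s)
  graph-scale {a} a∈C g with a ≟ 0#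
  graph-scale {a} {x} {s} a∈C g | yes a≈0 =
    outside (λ c c∈C c≉0 ax∼c → near-≉ c∈C c≉0 ax∼c (vanish x)) (trans (vanish x) (sym (vanish s)))
    where
    vanish : ∀ z → a * z ≈ 0#
    vanish z = trans (*-congʳ a≈0) (zeroˡ z)
  graph-scale {a} {x} {s} a∈C (inside c c∈C c≉0 x∼c eq) | no a≉0 =
    inside (a * c) (*-closed a∈C c∈C) (*-≉ a≉0 c≉0)
      (infinitesimal-resp (solve 3 (λ a x c → a :* (x :- c) := a :* x :- a :* c) refl a x c)
        (infinitesimal-scale a∈C a≉0 x∼c))
      (trans (solve 4 (λ a x c s → (a :* c :+ a :* c :- a :* x) :* (a :* s)
                := a :* c :* (a :* c) :+ a :* a :* ((c :+ c :- x) :* s :- c :* c)) refl a x c s)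
             (absorb _ eq))
  graph-scale {a} {x} {s} a∈C (outside x-out x≈s) | no a≉0 with inverse a a≉0
  ... | w , aw≈1 = outside
    (λ c c∈C c≉0 ax∼c → x-out (w * c) (*-closed w∈C c∈C) (*-≉ w≉0 c≉0)
      (infinitesimal-resp (trans (solve 4 (λ a w x c → w :* (a :* x :- c)
            := x :- w :* c :+ x :* (a :* w :- con (+ 1))) refl a w x c) (absorb x aw≈1))
        (infinitesimal-scale w∈C w≉0 ax∼c)))
    (*-congˡ x≈s)
    where
    w∈C : C w
    w∈C = inv-closed a∈C aw≈1
    w≉0 : ¬ w ≈ 0#
    w≉0 = invertible-≉ (trans (*-comm w a) aw≈1)

  -- The heart of the countermodel: z is the transported square of 1 + e. Here s = 1 / (1 - e),
  -- while 1 + 2e has image q = 1 / (1 - 2e), and q - s² = e² q s² is positive. So s² < q, and the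
  -- automorphism reflects the order.
  transported-square : ∀ {e s z} → Infinitesimal e → ¬ e ≈ 0# →
    Graph (1# + e) s → Graph z (s * s) → z < 1# + (e + e)
  transported-square {e} {s} {z} inf-e e≉0 gs gz with graph-total (1# + (e + e))
  ... | q , gq = graph-reflects-< gz gq (certify
    (*-pos (square-pos e≉0) (*-pos 0<q (square-pos (invertible-≉ s-inv))))
    (trans (solve 3 (λ e s q →
        let one = con (+ 1) ; ps = (one :- e) :* s in
        e :* e :* (q :* (s :* s)) := q :- s :* s
          :+ q :* (ps :+ one) :* (ps :- one)
          :+ (:- (s :* s)) :* ((one :- (e :+ e)) :* q :- one)) refl e s q)
      (trans (absorb _ q-eq) (absorb _ s-eq))))
    where
    e+e-inf : Infinitesimal (e + e)
    e+e-inf = infinitesimal-resp (solve 1 (λ e → con (+ 2) :* e := e :+ e) refl e) (infinitesimal-double inf-e)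
    -- The given graph may be presented through another centre, so s is compared with the explicit
    -- image by functionality of the graph.
    spec : ∀ {e s} → Infinitesimal e → Graph (1# + e) s → (1# - e) * s ≈ 1#
    spec {e} {s} inf-e gs with inverse (1# - e) (1-e≉0)
      where
      1-e≉0 : ¬ 1# - e ≈ 0#
      1-e≉0 = near-≉ 1-closed 1≉0 (infinitesimal-resp
        (solve 1 (λ e → :- e := con (+ 1) :- e :- con (+ 1)) refl e) (infinitesimal-neg inf-e))
    ... | w , pw≈1 = trans (*-congˡ (graph-cong gs (graph-near-1 inf-e pw≈1) refl)) pw≈1
    s-eq : (1# - e) * s ≈ 1#
    s-eq = spec inf-e gs
    q-eq : (1# - (e + e)) * q ≈ 1#
    q-eq = spec e+e-inf gq
    s-inv : s * (1# - e) ≈ 1#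
    s-inv = trans (*-comm _ _) s-eq
    0<q : 0# < q
    0<q = <-respʳ (*-identityʳ q) (near-same-sign 1-closed 1≉0
      (image-near 1-closed 1≉0 near-1 (trans
        (solve 2 (λ e q →
          (con (+ 2) :- (con (+ 1) :+ (e :+ e))) :* q := (con (+ 1) :- (e :+ e)) :* q) refl e q)
        (trans q-eq (sym (*-identityˡ 1#))))))
      where
      near-1 : Near 1# (1# + (e + e))
      near-1 = infinitesimal-resp (solve 1 (λ e → e :+ e := con (+ 1) :+ (e :+ e) :- con (+ 1)) refl e) e+e-inf

-- Soundness of natural deduction

record IsCongruent {L : Language} (M : RawStructure L) : Set where
  open Language L
  open RawStructure M
  field
    isEquivalence : IsEquivalence _≈_
    function-cong : ∀ {k} (f : Function k) {xs ys} → Pointwise _≈_ xs ys → ⟦ f ⟧ᶠ xs ≈ ⟦ f ⟧ᶠ ys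
    relation-cong : ∀ {k} (R : Relation k) {xs ys} → Pointwise _≈_ xs ys → ⟦ R ⟧ʳ xs → ⟦ R ⟧ʳ ys

  open IsEquivalence isEquivalence public

module _ {L : Language} {M : RawStructure L} (M-cong : IsCongruent M) where
  open RawStructure M
  open IsCongruent M-cong

  mutual
    eval-cong : ∀ {n} {η θ : Vec Carrier n} → Pointwise _≈_ η θ →
                ∀ t → eval M η t ≈ eval M θ t
    eval-cong η≈θ (var x)    = Pointwise.lookup η≈θ x
    eval-cong η≈θ (app f ts) = function-cong f (evals-cong η≈θ ts)

    evals-cong : ∀ {n k} {η θ : Vec Carrier n} → Pointwise _≈_ η θ →
                 ∀ (ts : Vec (Term L n) k) → Pointwise _≈_ (evals M η ts) (evals M θ ts)
    evals-cong η≈θ []       = []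
    evals-cong η≈θ (t ∷ ts) = eval-cong η≈θ t ∷ evals-cong η≈θ ts

  ⊨-cong : ∀ {n} {η θ : Vec Carrier n} → Pointwise _≈_ η θ → ∀ φ →
           _⊨_ M η φ → _⊨_ M θ φ
  ⊨-cong η≈θ (s ≐ t)    s≈t       = trans (sym (eval-cong η≈θ s)) (trans s≈t (eval-cong η≈θ t))
  ⊨-cong η≈θ (rel R ts) Rts       = relation-cong R (evals-cong η≈θ ts) Rts
  ⊨-cong η≈θ (φ ∧′ ψ)   (p , q)   = ⊨-cong η≈θ φ p , ⊨-cong η≈θ ψ q
  ⊨-cong η≈θ (φ ∨′ ψ)   (inj₁ p)  = inj₁ (⊨-cong η≈θ φ p)
  ⊨-cong η≈θ (φ ∨′ ψ)   (inj₂ q)  = inj₂ (⊨-cong η≈θ ψ q)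
  ⊨-cong η≈θ (φ ⇒′ ψ)   f p       = ⊨-cong η≈θ ψ (f (⊨-cong (Pointwise.sym sym η≈θ) φ p))
  ⊨-cong η≈θ (∀′ φ)     f x       = ⊨-cong (refl ∷ η≈θ) φ (f x)
  ⊨-cong η≈θ (∃′ φ)     (x , p)   = x , ⊨-cong (refl ∷ η≈θ) φ p

module _ {L : Language} (M : RawStructure L) where
  open RawStructure M

  module _ {T : Pred ℕ 0ℓ} (l : Lift T (Term L))
    (value : ∀ {n} → Vec Carrier n → T n → Carrier)
    (eval-lift : ∀ {n} (η : Vec Carrier n) x → eval M η (Lift.lift l x) ≡ value η x) where
    open TermApplication l using () renaming (_/_ to _/ˡ_; _/*_ to _/*ˡ_)

    mutual
      -- Generic in what is substituted, because it is needed twice: substituting terms under a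
      -- binder weakens them, and weakening is itself a substitution of variables.
      eval-/ˡ : ∀ {m n} (η : Vec Carrier n) (t : Term L m) (ρ : Sub T m n) →
                eval M η (t /ˡ ρ) ≡ eval M (Vec.map (value η) ρ) t
      eval-/ˡ η (var x)    ρ = ≡.trans (eval-lift η _) (≡.sym (Vec.lookup-map x (value η) ρ))
      eval-/ˡ η (app f ts) ρ = ≡.cong ⟦ f ⟧ᶠ (evals-/ˡ η ts ρ)

      evals-/ˡ : ∀ {m n k} (η : Vec Carrier n) (ts : Vec (Term L m) k) (ρ : Sub T m n) →
                 evals M η (ts /*ˡ ρ) ≡ evals M (Vec.map (value η) ρ) ts
      evals-/ˡ η []       ρ = ≡.refl
      evals-/ˡ η (t ∷ ts) ρ = ≡.cong₂ _∷_ (eval-/ˡ η t ρ) (evals-/ˡ η ts ρ)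

  private
    open TermSubst (termSubst {L}) using (varLift; weaken; id)

    lookup-weaken : ∀ {m n} x (η : Vec Carrier n) (is : Vec (Fin n) m) →
                    Vec.map (Vec.lookup (x ∷ η)) (Vec.map suc is) ≡ Vec.map (Vec.lookup η) is
    lookup-weaken x η is = ≡.sym (Vec.map-∘ _ _ is)

    lookup-id : ∀ {n} (η : Vec Carrier n) → Vec.map (Vec.lookup η) VarSubst.id ≡ η
    lookup-id []      = ≡.refl
    lookup-id (x ∷ η) = ≡.cong (x ∷_) (≡.trans (lookup-weaken x η VarSubst.id) (lookup-id η))

    eval-weaken : ∀ {n} x (η : Vec Carrier n) t → eval M (x ∷ η) (weaken t) ≡ eval M η t
    eval-weaken x η t = ≡.trans
      (eval-/ˡ varLift Vec.lookup (λ _ _ → ≡.refl) (x ∷ η) t VarSubst.wk)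
      (≡.cong (λ θ → eval M θ t) (≡.trans (lookup-weaken x η VarSubst.id) (lookup-id η)))

    map-weaken : ∀ {m n} x (η : Vec Carrier n) (ρ : Sub (Term L) m n) →
                 Vec.map (eval M (x ∷ η)) (Vec.map weaken ρ) ≡ Vec.map (eval M η) ρ
    map-weaken x η ρ = ≡.trans (≡.sym (Vec.map-∘ _ _ ρ)) (Vec.map-cong (eval-weaken x η) ρ)

    eval-id : ∀ {n} (η : Vec Carrier n) → Vec.map (eval M η) id ≡ η
    eval-id []      = ≡.refl
    eval-id (x ∷ η) = ≡.cong (x ∷_) (≡.trans (map-weaken x η id) (eval-id η))

    eval-/* : ∀ {m n k} (η : Vec Carrier n) (ts : Vec (Term L m) k) (ρ : Sub (Term L) m n) →
              evals M η (ts /* ρ) ≡ evals M (Vec.map (eval M η) ρ) ts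
    eval-/* = evals-/ˡ termLift (eval M) (λ _ _ → ≡.refl)

  eval-/ : ∀ {m n} (η : Vec Carrier n) (t : Term L m) (ρ : Sub (Term L) m n) →
           eval M η (t / ρ) ≡ eval M (Vec.map (eval M η) ρ) t
  eval-/ = eval-/ˡ termLift (eval M) (λ _ _ → ≡.refl)

  mutual
    ⊨-/ : ∀ {m n} (η : Vec Carrier n) (φ : Formula L m) (ρ : Sub (Term L) m n) →
          (_⊨_ M η (φ /ᶠ ρ)) ⇔ (_⊨_ M (Vec.map (eval M η) ρ) φ)
    ⊨-/ η ⊥′         ρ = mk⇔ (λ ()) (λ ())
    ⊨-/ η (s ≐ t)    ρ = mk⇔ (≡.subst₂ _≈_ (eval-/ η s ρ) (eval-/ η t ρ))
                             (≡.subst₂ _≈_ (≡.sym (eval-/ η s ρ)) (≡.sym (eval-/ η t ρ)))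
    ⊨-/ η (rel R ts) ρ = mk⇔ (≡.subst ⟦ R ⟧ʳ (eval-/* η ts ρ)) (≡.subst ⟦ R ⟧ʳ (≡.sym (eval-/* η ts ρ)))
    ⊨-/ η (φ ∧′ ψ)   ρ = mk⇔ (Product.map (to (⊨-/ η φ ρ)) (to (⊨-/ η ψ ρ)))
                             (Product.map (from (⊨-/ η φ ρ)) (from (⊨-/ η ψ ρ)))
    ⊨-/ η (φ ∨′ ψ)   ρ = mk⇔ (Sum.map (to (⊨-/ η φ ρ)) (to (⊨-/ η ψ ρ)))
                             (Sum.map (from (⊨-/ η φ ρ)) (from (⊨-/ η ψ ρ)))
    ⊨-/ η (φ ⇒′ ψ)   ρ = mk⇔ (λ f p → to (⊨-/ η ψ ρ) (f (from (⊨-/ η φ ρ) p)))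
                             (λ f p → from (⊨-/ η ψ ρ) (f (to (⊨-/ η φ ρ) p)))
    ⊨-/ η (∀′ φ)     ρ = mk⇔ (λ f x → to (⊨-/-bound η φ ρ x) (f x))
                             (λ f x → from (⊨-/-bound η φ ρ x) (f x))
    ⊨-/ η (∃′ φ)     ρ = mk⇔ (λ (x , p) → x , to (⊨-/-bound η φ ρ x) p)
                             (λ (x , p) → x , from (⊨-/-bound η φ ρ x) p)

    ⊨-/-bound : ∀ {m n} (η : Vec Carrier n) (φ : Formula L (suc m)) (ρ : Sub (Term L) m n) x →
                (_⊨_ M (x ∷ η) (φ /ᶠ ρ ↑)) ⇔ (_⊨_ M (x ∷ Vec.map (eval M η) ρ) φ)
    ⊨-/-bound η φ ρ x = ≡.subst (λ θ → (_⊨_ M (x ∷ η) (φ /ᶠ ρ ↑)) ⇔ (_⊨_ M (x ∷ θ) φ))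
                          (map-weaken x η ρ) (⊨-/ (x ∷ η) φ (ρ ↑))

  ⊨-sub : ∀ {n} (η : Vec Carrier n) φ t →
          (_⊨_ M η (φ /ᶠ sub t)) ⇔ (_⊨_ M (eval M η t ∷ η) φ)
  ⊨-sub η φ t = ≡.subst (λ θ → (_⊨_ M η (φ /ᶠ sub t)) ⇔ (_⊨_ M (eval M η t ∷ θ) φ))
                  (eval-id η) (⊨-/ η φ (sub t))

  ⊨-wk : ∀ {n} x (η : Vec Carrier n) φ → (_⊨_ M (x ∷ η) (wkᶠ φ)) ⇔ (_⊨_ M η φ)
  ⊨-wk x η φ = ≡.subst (λ θ → (_⊨_ M (x ∷ η) (wkᶠ φ)) ⇔ (_⊨_ M θ φ))
                 (≡.trans (map-weaken x η id) (eval-id η)) (⊨-/ (x ∷ η) φ wk)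

module _ {L : Language} {T : Theory L} where

  -- The membership proofs are kept since for `T[ F ]` they contain the additive or multiplicative
  -- sentence behind each axiom, from which its Skolem functions are read off.
  axiomsOf : ∀ {n} {Γ : List (Formula L n)} {φ} → T ∣ Γ ⊢ φ → List (∃ T)
  axiomsOf (axiom {σ = σ} σ∈T) = (σ , σ∈T) ∷ []
  axiomsOf (hyp _)         = []
  axiomsOf (raa d)         = axiomsOf d
  axiomsOf (∧-i d e)       = axiomsOf d ++ axiomsOf e
  axiomsOf (∧-e₁ d)        = axiomsOf d
  axiomsOf (∧-e₂ d)        = axiomsOf d
  axiomsOf (∨-i₁ d)        = axiomsOf d
  axiomsOf (∨-i₂ d)        = axiomsOf d
  axiomsOf (∨-e d e f)     = axiomsOf d ++ axiomsOf e ++ axiomsOf f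
  axiomsOf (⇒-i d)         = axiomsOf d
  axiomsOf (⇒-e d e)       = axiomsOf d ++ axiomsOf e
  axiomsOf (∀-i d)         = axiomsOf d
  axiomsOf (∀-e t d)       = axiomsOf d
  axiomsOf (∃-i t d)       = axiomsOf d
  axiomsOf (∃-e d e)       = axiomsOf d ++ axiomsOf e
  axiomsOf ≐-refl          = []
  axiomsOf (≐-subst φ d e) = axiomsOf d ++ axiomsOf e

  module _ (em : ExcludedMiddle 0ℓ) {M : RawStructure L} (M-cong : IsCongruent M) where
    open RawStructure M
    open IsCongruent M-cong

    Holds : ∃ T → Set
    Holds (σ , _) = Th M σ

    sound : ∀ {n} {Γ : List (Formula L n)} {φ} (d : T ∣ Γ ⊢ φ) → All Holds (axiomsOf d) →
            ∀ η → All (_⊨_ M η) Γ → _⊨_ M η φ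
    sound (axiom {σ = σ} _) (p ∷ []) η Γ = from (⊨-/ M η σ []) p
    sound (hyp φ∈Γ) as η Γ = All.lookup Γ φ∈Γ
    sound (raa {φ = φ} d) as η Γ with em {_⊨_ M η φ}
    ... | yes p = p
    ... | no ¬p = ⊥-elim (sound d as η (¬p ∷ Γ))
    sound (∧-i d e) as η Γ with All.++⁻ (axiomsOf d) as
    ... | as₁ , as₂ = sound d as₁ η Γ , sound e as₂ η Γ
    sound (∧-e₁ d) as η Γ = proj₁ (sound d as η Γ)
    sound (∧-e₂ d) as η Γ = proj₂ (sound d as η Γ)
    sound (∨-i₁ d) as η Γ = inj₁ (sound d as η Γ)
    sound (∨-i₂ d) as η Γ = inj₂ (sound d as η Γ)
    sound (∨-e d e f) as η Γ with All.++⁻ (axiomsOf d) as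
    ... | as₁ , as₂₃ with All.++⁻ (axiomsOf e) as₂₃ | sound d as₁ η Γ
    ...   | as₂ , _ | inj₁ p = sound e as₂ η (p ∷ Γ)
    ...   | _ , as₃ | inj₂ q = sound f as₃ η (q ∷ Γ)
    sound (⇒-i d) as η Γ p = sound d as η (p ∷ Γ)
    sound (⇒-e d e) as η Γ with All.++⁻ (axiomsOf d) as
    ... | as₁ , as₂ = sound d as₁ η Γ (sound e as₂ η Γ)
    sound (∀-i d) as η Γ x = sound d as (x ∷ η) (All.map⁺ (All.map (λ {ψ} → from (⊨-wk M x η ψ)) Γ))
    sound (∀-e {φ = φ} t d) as η Γ = from (⊨-sub M η φ t) (sound d as η Γ (eval M η t))
    sound (∃-i {φ = φ} t d) as η Γ = eval M η t , to (⊨-sub M η φ t) (sound d as η Γ)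
    sound (∃-e {ψ = ψ} d e) as η Γ with All.++⁻ (axiomsOf d) as
    ... | as₁ , as₂ with sound d as₁ η Γ
    ...   | x , p = to (⊨-wk M x η ψ)
                      (sound e as₂ (x ∷ η) (p ∷ All.map⁺ (All.map (λ {ψ} → from (⊨-wk M x η ψ)) Γ)))
    sound ≐-refl as η Γ = refl
    sound (≐-subst {s = s} {t = t} φ d e) as η Γ with All.++⁻ (axiomsOf d) as
    ... | as₁ , as₂ = from (⊨-sub M η φ t)
      (⊨-cong M-cong (sound d as₁ η Γ ∷ Pointwise.refl refl) φ (to (⊨-sub M η φ s) (sound e as₂ η Γ)))

-- Reducts and translated formulas

module _ {L L′ : Language} (ι : L ↪ L′) (M : RawStructure L′) where
  open RawStructure M
  open _↪_ ι

  reduct : RawStructure L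
  reduct = record
    { Carrier = Carrier
    ; _≈_     = _≈_
    ; ⟦_⟧ᶠ    = λ f → ⟦ onFunction f ⟧ᶠ
    ; ⟦_⟧ʳ    = λ R → ⟦ onRelation R ⟧ʳ
    }

  mutual
    eval-translate : ∀ {n} (η : Vec Carrier n) t → eval M η (translateTerm ι t) ≡ eval reduct η t
    eval-translate η (var x)    = ≡.refl
    eval-translate η (app f ts) = ≡.cong ⟦ onFunction f ⟧ᶠ (evals-translate η ts)

    evals-translate : ∀ {n k} (η : Vec Carrier n) (ts : Vec (Term L n) k) →
                      evals M η (translateTerms ι ts) ≡ evals reduct η ts
    evals-translate η []       = ≡.refl
    evals-translate η (t ∷ ts) = ≡.cong₂ _∷_ (eval-translate η t) (evals-translate η ts)

  ⊨-translate : ∀ {n} (η : Vec Carrier n) φ → (_⊨_ reduct η φ) ⇔ (_⊨_ M η (translate ι φ))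
  ⊨-translate η ⊥′         = mk⇔ (λ ()) (λ ())
  ⊨-translate η (s ≐ t)    = mk⇔
    (≡.subst₂ _≈_ (≡.sym (eval-translate η s)) (≡.sym (eval-translate η t)))
    (≡.subst₂ _≈_ (eval-translate η s) (eval-translate η t))
  ⊨-translate η (rel R ts) = mk⇔
    (≡.subst ⟦ onRelation R ⟧ʳ (≡.sym (evals-translate η ts)))
    (≡.subst ⟦ onRelation R ⟧ʳ (evals-translate η ts))
  ⊨-translate η (φ ∧′ ψ)   = mk⇔ (Product.map (to (⊨-translate η φ)) (to (⊨-translate η ψ)))
                                 (Product.map (from (⊨-translate η φ)) (from (⊨-translate η ψ)))
  ⊨-translate η (φ ∨′ ψ)   = mk⇔ (Sum.map (to (⊨-translate η φ)) (to (⊨-translate η ψ)))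
                                 (Sum.map (from (⊨-translate η φ)) (from (⊨-translate η ψ)))
  ⊨-translate η (φ ⇒′ ψ)   = mk⇔ (λ f p → to (⊨-translate η ψ) (f (from (⊨-translate η φ) p)))
                                 (λ f p → from (⊨-translate η ψ) (f (to (⊨-translate η φ) p)))
  ⊨-translate η (∀′ φ)     = mk⇔ (λ f x → to (⊨-translate (x ∷ η) φ) (f x))
                                 (λ f x → from (⊨-translate (x ∷ η) φ) (f x))
  ⊨-translate η (∃′ φ)     = mk⇔ (λ (x , p) → x , to (⊨-translate (x ∷ η) φ) p)
                                 (λ (x , p) → x , from (⊨-translate (x ∷ η) φ) p)

-- A countable nonstandard field

vectors : ∀ {A : Set} k → List A → List (Vec A k)
vectors zero    xs = [] ∷ []
vectors (suc k) xs = List.cartesianProductWith _∷_ xs (vectors k xs)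

∈-vectors : ∀ {A : Set} {k xs} {v : Vec A k} → VecAll.All (_∈ xs) v → v ∈ vectors k xs
∈-vectors []       = here ≡.refl
∈-vectors (p ∷ ps) = ∈-cartesianProductWith⁺ _∷_ p (∈-vectors ps)

∈-mapWith∈ : ∀ {A B : Set} {x} {xs : List A} (f : ∀ {x} → x ∈ xs → B) (p : x ∈ xs) → f p ∈ mapWith∈ xs f
∈-mapWith∈ f (here ≡.refl) = here ≡.refl
∈-mapWith∈ f (there p)     = there (∈-mapWith∈ (λ q → f (there q)) p)

module Quotients (ℝ : CompleteOrderedField) where
  open CompleteOrderedField ℝ
  open OrderedFieldProperties (orderedField ℝ)

  ÷-zero : ∀ {x y} → y ≈ 0# → x ÷ y ≈ 0#
  ÷-zero {y = y} y≈0 with y ≟ 0#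
  ... | yes _   = refl
  ... | no  y≉0 = ⊥-elim (y≉0 y≈0)

  ÷-inverse : ∀ {x y} → ¬ y ≈ 0# → y * (x ÷ y) ≈ x
  ÷-inverse {x} {y} y≉0 with y ≟ 0#
  ... | yes y≈0 = ⊥-elim (y≉0 y≈0)
  ... | no  y≉0′ = trans (solve 3 (λ x y w → y :* (x :* w) := x :+ x :* (y :* w :- con (+ 1))) refl x y _)
                        (absorb x (proj₂ (inverse y y≉0′)))

  ÷-cong : ∀ {x x′ y y′} → x ≈ x′ → y ≈ y′ → x ÷ y ≈ x′ ÷ y′
  ÷-cong {y = y} x≈x′ y≈y′ with toSum (y ≟ 0#)
  ... | inj₁ y≈0 = trans (÷-zero y≈0) (sym (÷-zero (trans (sym y≈y′) y≈0)))
  ... | inj₂ y≉0 = *-cancelˡ y≉0 (trans (÷-inverse y≉0) (trans x≈x′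
                     (trans (sym (÷-inverse (λ y′≈0 → y≉0 (trans y≈y′ y′≈0)))) (*-congʳ (sym y≈y′)))))

Operation : CompleteOrderedField → Set
Operation ℝ = ∃ λ k → Vec Carrier k → Carrier
  where open CompleteOrderedField ℝ

module Choice (em : ExcludedMiddle 0ℓ) (ℝ : CompleteOrderedField) where
  open CompleteOrderedField ℝ

  -- Makes a predicate an operation on the reals, so that deciding where a named function equals 1
  -- also decides the predicate.
  indicator : ∀ {A : Set} → Pred A 0ℓ → A → Carrier
  indicator P x with em {P x}
  ... | yes _ = 1#
  ... | no  _ = 0#

  indicator-≈1 : ∀ {A : Set} (P : Pred A 0ℓ) {x} → P x → indicator P x ≈ 1#
  indicator-≈1 P {x} p with em {P x}
  ... | yes _ = refl
  ... | no ¬p = ⊥-elim (¬p p)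

  indicator-≉1 : ∀ {A : Set} (P : Pred A 0ℓ) {x} → ¬ P x → ¬ indicator P x ≈ 1#
  indicator-≉1 P {x} ¬p with em {P x}
  ... | yes p = λ _ → ¬p p
  ... | no  _ = λ 0≈1 → 1≉0 (sym 0≈1)
    where open OrderedFieldProperties (orderedField ℝ)

  -- A Skolem function: excluded middle for the type `∃ (P x)` already delivers a witness.
  choose : ∀ {A : Set} → (A → Pred Carrier 0ℓ) → A → Carrier
  choose P x with em {∃ (P x)}
  ... | yes (y , _) = y
  ... | no  _       = 0#

  choose-spec : ∀ {A : Set} (P : A → Pred Carrier 0ℓ) {x} → ∃ (P x) → P x (choose P x)
  choose-spec P {x} ∃P with em {∃ (P x)}
  ... | yes (_ , p) = p
  ... | no  ¬∃P     = ⊥-elim (¬∃P ∃P)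

-- A countable substitute for an ultrapower: its elements are the functions
-- of t > 0 named by the terms over finitely many operations, and the sets
-- { t | c(t) ≈ 1 } are decided one after the other, so that no ultrafilter
-- is needed.
module GenericField (em : ExcludedMiddle 0ℓ) (ℝ : CompleteOrderedField) (extra : List (Operation ℝ)) where
  private module R = OrderedField (orderedField ℝ)
  open CompleteOrderedField ℝ
  open OrderedFieldProperties (orderedField ℝ)
  open Quotients ℝ
  open Choice em ℝ

  less : Pred (Vec Carrier 2) 0ℓ
  less (x ∷ y ∷ []) = x < y

  operations : List (Operation ℝ)
  operations = (0 , λ _ → 0#)
             ∷ (0 , λ _ → 1#)
             ∷ (2 , λ { (x ∷ y ∷ []) → x + y })
             ∷ (2 , λ { (x ∷ y ∷ []) → x * y })
             ∷ (1 , λ { (x ∷ []) → - x })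
             ∷ (2 , λ { (x ∷ y ∷ []) → x ÷ y })
             ∷ (2 , indicator less)
             ∷ extra

  extra∈ : ∀ {o} → o ∈ extra → o ∈ operations
  extra∈ p = there (there (there (there (there (there (there p))))))

  -- Terms in one variable t. An operation is named by its position in the list, as functions
  -- themselves cannot be compared; hence the enumeration below maps with membership proofs.
  data Code : Set where
    generic : Code
    node    : ∀ {k g} → (k , g) ∈ operations → Vec Code k → Code

  mutual
    den : Code → Carrier → Carrier
    den generic          t = t
    den (node {g = g} _ cs) t = g (dens cs t)

    dens : ∀ {k} → Vec Code k → Carrier → Vec Carrier k
    dens []       t = []
    dens (c ∷ cs) t = den c t ∷ dens cs t

  codes : ℕ → List Code
  codes zero    = generic ∷ []
  codes (suc n) = codes n ++ List.concat
    (mapWith∈ operations λ {(k , _)} p → List.map (node p) (vectors k (codes n)))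

  codes-mono : ∀ {m n} → m ℕ.≤′ n → ∀ {c} → c ∈ codes m → c ∈ codes n
  codes-mono (ℕ.≤′-reflexive ≡.refl) p = p
  codes-mono (ℕ.≤′-step m≤n)         p = ∈-++⁺ˡ (codes-mono m≤n p)

  mutual
    codes-complete : ∀ c → ∃ λ n → c ∈ codes n
    codes-complete generic     = 0 , here ≡.refl
    codes-complete (node p cs) with codes-completes cs
    ... | n , ps = suc n , ∈-++⁺ʳ (codes n)
      (∈-concat⁺′ (∈-map⁺ (node p) (∈-vectors ps))
        (∈-mapWith∈ (λ {(k , _)} p → List.map (node p) (vectors k (codes n))) p))

    codes-completes : ∀ {k} (cs : Vec Code k) → ∃ λ n → VecAll.All (_∈ codes n) cs
    codes-completes []       = 0 , []
    codes-completes (c ∷ cs) with codes-complete c | codes-completes cs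
    ... | m , p | n , ps = m ℕ.⊔ n
      , codes-mono (ℕ.≤⇒≤′ (ℕ.m≤m⊔n m n)) p
      ∷ VecAll.map (codes-mono (ℕ.≤⇒≤′ (ℕ.m≤n⊔m m n))) ps

  -- The invariant of all stages. It keeps them nonempty and makes the identity function, named
  -- `generic`, a positive infinitesimal.
  Accumulates : Pred Carrier 0ℓ → Set
  Accumulates S = ∀ {δ} → 0# < δ → ∃ λ t → 0# < t × t < δ × S t

  minimum : ∀ {δ ε} → 0# < δ → 0# < ε → ∃ λ μ → 0# < μ × (∀ {t} → t < μ → t < δ × t < ε)
  minimum {δ} {ε} 0<δ 0<ε with R.compare δ ε
  ... | tri< δ<ε _ _ = δ , 0<δ , λ t<δ → t<δ , R.<-trans t<δ δ<ε
  ... | tri≈ _ δ≈ε _ = δ , 0<δ , λ t<δ → t<δ , R.<-respʳ δ≈ε t<δ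
  ... | tri> _ _ ε<δ = ε , 0<ε , λ t<ε → R.<-trans t<ε ε<δ , t<ε

  refine : Pred Carrier 0ℓ → Pred Carrier 0ℓ → Pred Carrier 0ℓ
  refine S A with em {Accumulates (S ∩ A)}
  ... | yes _ = S ∩ A
  ... | no  _ = S ∩ ∁ A

  refine-⊆ : ∀ S A → refine S A ⊆ S
  refine-⊆ S A with em {Accumulates (S ∩ A)}
  ... | yes _ = proj₁
  ... | no  _ = proj₁

  refine-decides : ∀ S A → (refine S A ⊆ A) ⊎ (refine S A ⊆ ∁ A)
  refine-decides S A with em {Accumulates (S ∩ A)}
  ... | yes _ = inj₁ proj₂
  ... | no  _ = inj₂ proj₂

  -- If S ∩ A does not accumulate at 0, some interval (0, ε) contains no point of it; the points of
  -- S in that interval then all lie outside A.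
  refine-accumulates : ∀ {S} A → Accumulates S → Accumulates (refine S A)
  refine-accumulates {S} A acc with em {Accumulates (S ∩ A)}
  ... | yes acc∩ = acc∩
  ... | no ¬acc∩ with em {∃ λ δ → 0# < δ × (∀ {t} → 0# < t → t < δ → S t → ¬ A t)}
  ...   | no  ¬gap = ⊥-elim (¬acc∩ λ {δ} 0<δ → decidable-stable em λ none →
            ¬gap (δ , 0<δ , λ {t} 0<t t<δ t∈S t∈A → none (t , 0<t , t<δ , t∈S , t∈A)))
  ...   | yes (ε , 0<ε , gap) = λ 0<δ → let (μ , 0<μ , μ≤) = minimum 0<δ 0<ε
                                            (t , 0<t , t<μ , t∈S) = acc 0<μ
                                            (t<δ , t<ε) = μ≤ t<μ
                                        in t , 0<t , t<δ , t∈S , gap 0<t t<ε t∈S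

  Truth : Code → Pred Carrier 0ℓ
  Truth c t = den c t ≈ 1#

  refines : Pred Carrier 0ℓ → List Code → Pred Carrier 0ℓ
  refines S []       = S
  refines S (c ∷ cs) = refines (refine S (Truth c)) cs

  refines-⊆ : ∀ S cs → refines S cs ⊆ S
  refines-⊆ S []       p = p
  refines-⊆ S (c ∷ cs) p = refine-⊆ S (Truth c) (refines-⊆ _ cs p)

  refines-decides : ∀ S {c cs} → c ∈ cs → (refines S cs ⊆ Truth c) ⊎ (refines S cs ⊆ ∁ (Truth c))
  refines-decides S {c} {_ ∷ cs} (here ≡.refl) = Sum.map
    (λ ⊆A p → ⊆A (refines-⊆ _ cs p)) (λ ⊆∁A p → ⊆∁A (refines-⊆ _ cs p)) (refine-decides S (Truth c))
  refines-decides S (there p) = refines-decides _ p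

  refines-accumulates : ∀ {S} cs → Accumulates S → Accumulates (refines S cs)
  refines-accumulates []       acc = acc
  refines-accumulates (c ∷ cs) acc = refines-accumulates cs (refine-accumulates (Truth c) acc)

  stage : ℕ → Pred Carrier 0ℓ
  stage zero    t = ⊤
  stage (suc n)   = refines (stage n) (codes n)

  stage-anti : ∀ {m n} → m ℕ.≤′ n → stage n ⊆ stage m
  stage-anti (ℕ.≤′-reflexive ≡.refl) p = p
  stage-anti {n = suc n} (ℕ.≤′-step m≤n) p = stage-anti m≤n (refines-⊆ _ (codes n) p)

  stage-accumulates : ∀ n → Accumulates (stage n)
  stage-accumulates (suc n) = refines-accumulates (codes n) (stage-accumulates n)
  stage-accumulates zero {δ} 0<δ with R.inverse (1# + 1#) (<⇒≉ 0<2)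
  ... | h , 2h≈1 = h * δ , *-pos 0<h 0<δ
      , certify (*-pos 0<h 0<δ) (trans
          (solve 2 (λ h δ → h :* δ := δ :- h :* δ :+ δ :* (con (+ 2) :* h :- con (+ 1))) refl h δ)
          (absorb δ 2h≈1))
      , tt
    where
    0<h : 0# < h
    0<h = pos-cancelˡ 0<2 (R.<-respʳ (sym 2h≈1) 0<1)

  -- The filter generated by the stages. It is proper by accumulation, and it decides the sets
  -- `Truth c`, which is as much of an ultrafilter as the theorem of Łoś calls for.
  Large : Pred Carrier 0ℓ → Set
  Large A = ∃ λ n → ∀ {t} → stage n t → A t

  large-all : ∀ {A} → (∀ t → A t) → Large A
  large-all f = 0 , λ {t} _ → f t

  large-map : ∀ {A B : Pred Carrier 0ℓ} → (∀ {t} → A t → B t) → Large A → Large B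
  large-map f (n , ⊆A) = n , λ p → f (⊆A p)

  large-map₂ : ∀ {A B C : Pred Carrier 0ℓ} → (∀ {t} → A t → B t → C t) → Large A → Large B → Large C
  large-map₂ f (m , ⊆A) (n , ⊆B) = m ℕ.⊔ n , λ p →
    f (⊆A (stage-anti (ℕ.≤⇒≤′ (ℕ.m≤m⊔n m n)) p)) (⊆B (stage-anti (ℕ.≤⇒≤′ (ℕ.m≤n⊔m m n)) p))

  large-accumulates : ∀ {A} → Large A → Accumulates A
  large-accumulates (n , ⊆A) 0<δ with stage-accumulates n 0<δ
  ... | t , 0<t , t<δ , p = t , 0<t , t<δ , ⊆A p

  large-satisfiable : ∀ {A} → Large A → ∃ A
  large-satisfiable large with large-accumulates large 0<1
  ... | t , _ , _ , p = t , p

  large-proper : ∀ {A : Pred Carrier 0ℓ} → Large A → ¬ Large (∁ A)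
  large-proper large large∁ with large-satisfiable (large-map₂ _,_ large large∁)
  ... | _ , p , ¬p = ¬p p

  decided : ∀ {k} (P : Pred (Vec Carrier k) 0ℓ) → (k , indicator P) ∈ operations → ∀ cs →
            Large (λ t → P (dens cs t)) ⊎ Large (λ t → ¬ P (dens cs t))
  decided P p cs with codes-complete (node p cs)
  ... | n , c∈ = Sum.map
    (λ ⊆1 → suc n , λ {t} q → decidable-stable em (λ ¬P → indicator-≉1 P ¬P (⊆1 q)))
    (λ ⊆∁1 → suc n , λ {t} q Pt → ⊆∁1 q (indicator-≈1 P Pt))
    (refines-decides (stage n) c∈)

  infix 4 _≈ᶜ_ _<ᶜ_

  -- A record and not a synonym for `Large`, so that both codes can be inferred from the type.
  record _≈ᶜ_ (c d : Code) : Set where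
    constructor eventually-≈
    field large-≈ : Large (λ t → den c t ≈ den d t)

  record _<ᶜ_ (c d : Code) : Set where
    constructor eventually-<
    field large-< : Large (λ t → den c t < den d t)

  open _≈ᶜ_ public
  open _<ᶜ_ public

  infixl 7 _*ᶜ_ _÷ᶜ_
  infixl 6 _+ᶜ_

  0ᶜ 1ᶜ : Code
  0ᶜ = node (here ≡.refl) []
  1ᶜ = node (there (here ≡.refl)) []

  _+ᶜ_ _*ᶜ_ _÷ᶜ_ : Code → Code → Code
  c +ᶜ d = node (there (there (here ≡.refl))) (c ∷ d ∷ [])
  c *ᶜ d = node (there (there (there (here ≡.refl)))) (c ∷ d ∷ [])
  c ÷ᶜ d = node (there (there (there (there (there (here ≡.refl)))))) (c ∷ d ∷ [])

  -ᶜ_ : Code → Code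
  -ᶜ c = node (there (there (there (there (here ≡.refl))))) (c ∷ [])

  everywhere : ∀ {c d} → (∀ t → den c t ≈ den d t) → c ≈ᶜ d
  everywhere f = eventually-≈ (large-all f)

  ≈ᶜ-map : ∀ {c c′ d d′} → (∀ {t} → den c t ≈ den c′ t → den d t ≈ den d′ t) → c ≈ᶜ c′ → d ≈ᶜ d′
  ≈ᶜ-map f (eventually-≈ p) = eventually-≈ (large-map f p)

  ≈ᶜ-map₂ : ∀ {c c′ d d′ e e′} → (∀ {t} → den c t ≈ den c′ t → den d t ≈ den d′ t → den e t ≈ den e′ t) →
            c ≈ᶜ c′ → d ≈ᶜ d′ → e ≈ᶜ e′
  ≈ᶜ-map₂ f (eventually-≈ p) (eventually-≈ q) = eventually-≈ (large-map₂ f p q)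

  abstract
    isCommutativeRingᶜ : IsCommutativeRing _≈ᶜ_ _+ᶜ_ _*ᶜ_ -ᶜ_ 0ᶜ 1ᶜ
    isCommutativeRingᶜ = record
      { isRing = record
        { +-isAbelianGroup = record
          { isGroup = record
            { isMonoid = record
              { isSemigroup = record
                { isMagma = record
                  { isEquivalence = record
                    { refl  = everywhere λ _ → refl
                    ; sym   = ≈ᶜ-map sym
                    ; trans = ≈ᶜ-map₂ trans
                    }
                  ; ∙-cong = ≈ᶜ-map₂ +-cong
                  }
                ; assoc = λ _ _ _ → everywhere λ _ → +-assoc _ _ _
                }
              ; identity = (λ _ → everywhere λ _ → +-identityˡ _) , (λ _ → everywhere λ _ → +-identityʳ _)
              }
            ; inverse = (λ _ → everywhere λ _ → -‿inverseˡ _) , (λ _ → everywhere λ _ → -‿inverseʳ _)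
            ; ⁻¹-cong = ≈ᶜ-map -‿cong
            }
          ; comm = λ _ _ → everywhere λ _ → +-comm _ _
          }
        ; *-cong     = ≈ᶜ-map₂ *-cong
        ; *-assoc    = λ _ _ _ → everywhere λ _ → *-assoc _ _ _
        ; *-identity = (λ _ → everywhere λ _ → *-identityˡ _) , (λ _ → everywhere λ _ → *-identityʳ _)
        ; distrib    = (λ _ _ _ → everywhere λ _ → distribˡ _ _ _) , (λ _ _ _ → everywhere λ _ → distribʳ _ _ _)
        }
      ; *-comm = λ _ _ → everywhere λ _ → *-comm _ _
      }

  codeRing : CommutativeRing 0ℓ 0ℓ
  codeRing = record { isCommutativeRing = isCommutativeRingᶜ }

  ≮ᶜ : ∀ {c d} → Large (λ t → ¬ den c t < den d t) → ¬ c <ᶜ d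
  ≮ᶜ large (eventually-< p) = large-proper p large

  less-decided : ∀ c d → Large (λ t → den c t < den d t) ⊎ Large (λ t → ¬ den c t < den d t)
  less-decided c d = decided less (there (there (there (there (there (there (here ≡.refl))))))) (c ∷ d ∷ [])

  compareᶜ : Trichotomous _≈ᶜ_ _<ᶜ_
  compareᶜ c d with less-decided c d | less-decided d c
  ... | inj₁ c<d | _        = tri< (eventually-< c<d)
          (λ (eventually-≈ p) → large-proper c<d (large-map R.<-irrefl p))
          (≮ᶜ (large-map (λ c<d d<c → R.<-irrefl refl (R.<-trans c<d d<c)) c<d))
  ... | inj₂ c≮d | inj₁ d<c = tri> (≮ᶜ c≮d)
          (λ (eventually-≈ p) → large-proper d<c (large-map (λ e → R.<-irrefl (sym e)) p))
          (eventually-< d<c)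
  ... | inj₂ c≮d | inj₂ d≮c = tri≈ (≮ᶜ c≮d) (eventually-≈ (large-map₂ incomparable c≮d d≮c)) (≮ᶜ d≮c)
    where
    incomparable : ∀ {x y} → ¬ x < y → ¬ y < x → x ≈ y
    incomparable {x} {y} x≮y y≮x with R.compare x y
    ... | tri< x<y _ _ = ⊥-elim (x≮y x<y)
    ... | tri≈ _ x≈y _ = x≈y
    ... | tri> _ _ y<x = ⊥-elim (y≮x y<x)

  -- In a mere filter a set that is not large need not have a large complement; trichotomy of codes
  -- supplies the large set.
  nonzero : ∀ {c} → ¬ c ≈ᶜ 0ᶜ → Large (λ t → ¬ den c t ≈ 0#)
  nonzero {c} c≉0 with compareᶜ c 0ᶜ
  ... | tri< (eventually-< c<0) _ _ = large-map (λ c<0 c≈0 → R.<-irrefl c≈0 c<0) c<0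
  ... | tri≈ _ c≈0 _                = ⊥-elim (c≉0 c≈0)
  ... | tri> _ _ (eventually-< 0<c) = large-map <⇒≉ 0<c

  abstract
    isStrictTotalOrderᶜ : IsStrictTotalOrder _≈ᶜ_ _<ᶜ_
    isStrictTotalOrderᶜ = record
      { isStrictPartialOrder = record
        { isEquivalence = CommutativeRing.isEquivalence codeRing
        ; irrefl  = λ (eventually-≈ p) → ≮ᶜ (large-map R.<-irrefl p)
        ; trans   = λ (eventually-< p) (eventually-< q) → eventually-< (large-map₂ R.<-trans p q)
        ; <-resp-≈ = (λ (eventually-≈ p) (eventually-< q) → eventually-< (large-map₂ R.<-respʳ p q))
                   , (λ (eventually-≈ p) (eventually-< q) → eventually-< (large-map₂ R.<-respˡ p q))
        }
      ; compare = compareᶜ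
      }

    inverseᶜ : ∀ c → ¬ c ≈ᶜ 0ᶜ → ∃ λ d → c *ᶜ d ≈ᶜ 1ᶜ
    inverseᶜ c c≉0 = 1ᶜ ÷ᶜ c , eventually-≈ (large-map ÷-inverse (nonzero c≉0))

  genericField : OrderedField
  genericField = record
    { commutativeRing    = codeRing
    ; _<_                = _<ᶜ_
    ; isStrictTotalOrder = isStrictTotalOrderᶜ
    ; 0<1                = eventually-< (large-all λ _ → 0<1)
    ; inverse            = inverseᶜ
    ; +-mono-<           = λ _ (eventually-< p) → eventually-< (large-map (+-mono-< _) p)
    ; *-pos              = λ (eventually-< p) (eventually-< q) → eventually-< (large-map₂ *-pos p q)
    }

  Standard : Pred Code 0ℓ
  Standard c = ∃ λ a → Large (λ t → den c t ≈ a)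

  standard-subfield : IsSubfield genericField Standard
  standard-subfield = record
    { 1-closed   = 1# , large-all (λ _ → refl)
    ; +-closed   = λ (a , p) (b , q) → a + b , large-map₂ +-cong p q
    ; neg-closed = λ (a , p) → - a , large-map -‿cong p
    ; *-closed   = λ (a , p) (b , q) → a * b , large-map₂ *-cong p q
    ; inv-closed = λ {x} {y} (a , p) (eventually-≈ q) →
        inv {y} a (large-map₂ (λ x≈a xy≈1 → trans (*-congʳ (sym x≈a)) xy≈1) p q)
    }
    where
    inv : ∀ {y} a → Large (λ t → a * den y t ≈ 1#) → Standard y
    inv a ay≈1 with large-satisfiable ay≈1
    ... | _ , ay≈1′ with R.inverse a (invertible-≉ ay≈1′)
    ...   | b , ab≈1 = b , large-map (λ ay≈1 → *-cancelˡ (invertible-≉ ab≈1) (trans ay≈1 (sym ab≈1))) ay≈1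

  open MonadAutomorphism em genericField Standard standard-subfield public

  -- Here b stands for |a|: a large set has members t with 0 < t < b, and there t² < b² = a².
  generic-square-small : ∀ {d a b} → Large (λ t → den d t ≈ a) →
                         Large (λ t → ¬ t * t < den d t * den d t) →
                         0# < b → ¬ b * b ≈ a * a
  generic-square-small {a = a} {b} d≈a t²≮d² 0<b b²≈a²
    with large-accumulates (large-map₂ _,_ d≈a t²≮d²) 0<b
  ... | t , 0<t , t<b , d≈a′ , t²≮d²′ = t²≮d²′
    (R.<-respʳ (trans b²≈a² (*-cong (sym d≈a′) (sym d≈a′))) (certify
      (*-pos (positive-difference t<b) (+-pos 0<t (R.<-trans 0<t t<b)))
      (solve 2 (λ t b → (b :- t) :* (t :+ b) := b :* b :- t :* t) refl t b)))

  generic-infinitesimal : Infinitesimal generic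
  generic-infinitesimal {d} (a , d≈a) d≉0 = Sum.[ eventually-< , (λ t²≮d² → ⊥-elim (excluded t²≮d²)) ]′
    (less-decided (generic *ᶜ generic) (d *ᶜ d))
    where
    sign : (b : Tri (a < 0#) (a ≈ 0#) (0# < a)) → Large (λ t → ¬ t * t < den d t * den d t) → ⊥
    sign (tri< a<0 _ _) t²≮d² = generic-square-small {d} d≈a t²≮d² (neg-pos a<0)
                                  (solve 1 (λ a → (:- a) :* (:- a) := a :* a) refl a)
    sign (tri≈ _ a≈0 _) _     = d≉0 (eventually-≈ (large-map (λ d≈a → trans d≈a a≈0) d≈a))
    sign (tri> _ _ 0<a) t²≮d² = generic-square-small {d} d≈a t²≮d² 0<a refl
    excluded : Large (λ t → ¬ t * t < den d t * den d t) → ⊥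
    excluded = sign (R.compare a 0#)

  generic-pos : 0ᶜ <ᶜ generic
  generic-pos = Sum.[ eventually-< , (λ 0≮t → ⊥-elim (excluded 0≮t)) ]′ (less-decided 0ᶜ generic)
    where
    excluded : Large (λ t → ¬ 0# < t) → ⊥
    excluded 0≮t = let (t , 0<t , _ , 0≮t′) = large-accumulates 0≮t 0<1 in 0≮t′ 0<t

-- The theorem of Łoś

module Skolemization (em : ExcludedMiddle 0ℓ) (ℝ : CompleteOrderedField) {L : Language}
  (⟦_⟧ᶠ : ∀ {k} → Language.Function L k →
          Vec (CompleteOrderedField.Carrier ℝ) k → CompleteOrderedField.Carrier ℝ)
  (⟦_⟧ʳ : ∀ {k} → Language.Relation L k → Vec (CompleteOrderedField.Carrier ℝ) k → Set) where
  open CompleteOrderedField ℝ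
  open Choice em ℝ

  structure : RawStructure L
  structure = record { Carrier = Carrier ; _≈_ = _≈_ ; ⟦_⟧ᶠ = ⟦_⟧ᶠ ; ⟦_⟧ʳ = ⟦_⟧ʳ }

  Satisfies Refutes : ∀ {n} → Formula L n → Vec Carrier n → Set
  Satisfies φ η = _⊨_ structure η φ
  Refutes φ η = ¬ Satisfies φ η

  mutual
    operationsOfTerm : ∀ {n} → Term L n → List (Operation ℝ)
    operationsOfTerm (var x)    = []
    operationsOfTerm (app f ts) = (_ , ⟦ f ⟧ᶠ) ∷ operationsOfTerms ts

    operationsOfTerms : ∀ {n k} → Vec (Term L n) k → List (Operation ℝ)
    operationsOfTerms []       = []
    operationsOfTerms (t ∷ ts) = operationsOfTerm t ++ operationsOfTerms ts

  truth : ∀ {n} → Formula L n → Operation ℝ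
  truth φ = _ , indicator (Satisfies φ)

  witness counterexample : ∀ {n} → Formula L (suc n) → Operation ℝ
  witness        {n} φ = n , choose (λ η x → Satisfies φ (x ∷ η))
  counterexample {n} φ = n , choose (λ η x → Refutes φ (x ∷ η))

  -- What the theorem of Łoś needs in the list: function symbols, Skolem functions, and truth values
  -- of those subformulas that must be decided. A filter commutes with ∧ by itself, whereas ∨, ⇒ and
  -- ∀ appeal to a decision.
  operationsOf : ∀ {n} → Formula L n → List (Operation ℝ)
  operationsOf ⊥′         = []
  operationsOf (s ≐ t)    = operationsOfTerm s ++ operationsOfTerm t
  operationsOf (rel R ts) = operationsOfTerms ts
  operationsOf (φ ∧′ ψ)   = operationsOf φ ++ operationsOf ψ
  operationsOf (φ ∨′ ψ)   = truth φ ∷ operationsOf φ ++ operationsOf ψ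
  operationsOf (φ ⇒′ ψ)   = truth φ ∷ operationsOf φ ++ operationsOf ψ
  operationsOf (∀′ φ)     = truth (∀′ φ) ∷ counterexample φ ∷ operationsOf φ
  operationsOf (∃′ φ)     = witness φ ∷ operationsOf φ

  module Łoś (S-cong : IsCongruent structure) (extra : List (Operation ℝ)) where
    open GenericField em ℝ extra

    -- The generic power of the structure, seen through a bijection h.
    module Representation
      (⟦_⟧ᶠᶜ : ∀ {k} → Language.Function L k → Vec Code k → Code)
      (⟦_⟧ʳᶜ : ∀ {k} → Language.Relation L k → Vec Code k → Set)
      (h : Code → Code)
      (h-onto : ∀ d → ∃ λ c → h c ≈ᶜ d)
      (h-≈ : ∀ {c d} → (c ≈ᶜ d) ⇔ (h c ≈ᶜ h d))
      (h-function : ∀ {k} (f : Language.Function L k) → (k , ⟦ f ⟧ᶠ) ∈ operations → ∀ cs →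
        Large (λ t → den (h (⟦ f ⟧ᶠᶜ cs)) t ≈ ⟦ f ⟧ᶠ (dens (Vec.map h cs) t)))
      (h-relation : ∀ {k} (R : Language.Relation L k) cs →
        ⟦ R ⟧ʳᶜ cs ⇔ Large (λ t → ⟦ R ⟧ʳ (dens (Vec.map h cs) t)))
      where
      open IsCongruent S-cong using (function-cong; relation-cong)

      model : RawStructure L
      model = record { Carrier = Code ; _≈_ = _≈ᶜ_ ; ⟦_⟧ᶠ = ⟦_⟧ᶠᶜ ; ⟦_⟧ʳ = ⟦_⟧ʳᶜ }

      at : ∀ {n} → Vec Code n → Carrier → Vec Carrier n
      at η = dens (Vec.map h η)

      lookup-at : ∀ {n} (η : Vec Code n) t x → den (h (Vec.lookup η x)) t ≈ Vec.lookup (at η t) x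
      lookup-at (c ∷ η) t Fin.zero    = refl
      lookup-at (c ∷ η) t (Fin.suc x) = lookup-at η t x

      mutual
        łoś-term : ∀ {n} (s : Term L n) → operationsOfTerm s ⊆ˡ operations → ∀ η →
                   Large (λ t → den (h (eval model η s)) t ≈ eval structure (at η t) s)
        łoś-term (var x)    _   η = large-all (λ t → lookup-at η t x)
        łoś-term (app f ts) ops η = large-map₂ (λ p q → trans p (function-cong f q))
          (h-function f (ops (here ≡.refl)) (evals model η ts)) (łoś-terms ts (ops ∘ there) η)

        łoś-terms : ∀ {n k} (ts : Vec (Term L n) k) → operationsOfTerms ts ⊆ˡ operations → ∀ η →
                    Large (λ t → Pointwise _≈_ (at (evals model η ts) t) (evals structure (at η t) ts))
        łoś-terms []       _   η = large-all (λ _ → [])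
        łoś-terms (s ∷ ts) ops η = large-map₂ _∷_
          (łoś-term s (ops ∘ ∈-++⁺ˡ) η) (łoś-terms ts (ops ∘ ∈-++⁺ʳ (operationsOfTerm s)) η)

      Eventually : ∀ {n} → Vec Code n → Formula L n → Set
      Eventually η φ = Large (λ t → Satisfies φ (at η t))

      eventually-decided : ∀ {n} (φ : Formula L n) → truth φ ∈ operations → ∀ η →
                           Eventually η φ ⊎ Large (λ t → Refutes φ (at η t))
      eventually-decided φ p η = decided (Satisfies φ) p (Vec.map h η)

      -- Quantifiers range over codes c while formulas see h c. A Skolem code d is therefore pulled
      -- back along the surjection h, and h c may then be exchanged for d.
      replace : ∀ {n} (φ : Formula L (suc n)) {c d} (η : Vec Code n) → h c ≈ᶜ d →
                Large (λ t → Pointwise _≈_ (den d t ∷ at η t) (at (c ∷ η) t))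
      replace φ η (eventually-≈ hc≈d) = large-map (λ e → sym e ∷ Pointwise.refl refl) hc≈d

      łoś : ∀ {n} (φ : Formula L n) → operationsOf φ ⊆ˡ operations → ∀ η →
            (_⊨_ model η φ) ⇔ Eventually η φ
      łoś ⊥′         ops η = mk⇔ (λ ()) (proj₂ ∘ large-satisfiable)
      łoś (s ≐ t)    ops η = mk⇔
        (λ e → large-map₂ (λ p (q , r) → trans (sym p) (trans q r)) s-eval
                 (large-map₂ _,_ (large-≈ (to h-≈ e)) t-eval))
        (λ l → from h-≈ (eventually-≈ (large-map₂ (λ p (q , r) → trans p (trans q (sym r))) s-eval
                 (large-map₂ _,_ l t-eval))))
        where
        s-eval = łoś-term s (ops ∘ ∈-++⁺ˡ) η
        t-eval = łoś-term t (ops ∘ ∈-++⁺ʳ (operationsOfTerm s)) η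
      łoś (rel R ts) ops η = mk⇔
        (λ r → large-map₂ (relation-cong R) (łoś-terms ts ops η) (to (h-relation R _) r))
        (λ l → from (h-relation R _)
                 (large-map₂ (λ p → relation-cong R (Pointwise.sym sym p)) (łoś-terms ts ops η) l))
      łoś (φ ∧′ ψ)   ops η = mk⇔
        (λ (p , q) → large-map₂ _,_ (to łφ p) (to łψ q))
        (λ l → from łφ (large-map proj₁ l) , from łψ (large-map proj₂ l))
        where
        łφ = łoś φ (ops ∘ ∈-++⁺ˡ) η
        łψ = łoś ψ (ops ∘ ∈-++⁺ʳ (operationsOf φ)) η
      łoś (φ ∨′ ψ)   ops η = mk⇔
        Sum.[ large-map inj₁ ∘ to łφ , large-map inj₂ ∘ to łψ ]′
        (λ l → Sum.map (from łφ) (λ ¬φ → from łψ (large-map₂ (λ ¬p → Sum.[ ⊥-elim ∘ ¬p , (λ q → q) ]′) ¬φ l))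
                 (eventually-decided φ (ops (here ≡.refl)) η))
        where
        łφ = łoś φ (ops ∘ there ∘ ∈-++⁺ˡ) η
        łψ = łoś ψ (ops ∘ there ∘ ∈-++⁺ʳ (operationsOf φ)) η
      łoś (φ ⇒′ ψ)   ops η = mk⇔
        (λ f → Sum.[ (λ l → large-map (λ q _ → q) (to łψ (f (from łφ l)))) , large-map (λ ¬p p → ⊥-elim (¬p p)) ]′
                 (eventually-decided φ (ops (here ≡.refl)) η))
        (λ l p → from łψ (large-map₂ (λ f x → f x) l (to łφ p)))
        where
        łφ = łoś φ (ops ∘ there ∘ ∈-++⁺ˡ) η
        łψ = łoś ψ (ops ∘ there ∘ ∈-++⁺ʳ (operationsOf φ)) η
      łoś (∀′ φ)     ops η = mk⇔
        (λ f → Sum.[ (λ l → l) , (λ l → ⊥-elim (refuted f l)) ]′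
                 (eventually-decided (∀′ φ) (ops (here ≡.refl)) η))
        (λ l c → from (łφ (c ∷ η)) (large-map (λ f → f _) l))
        where
        łφ = łoś φ (ops ∘ there ∘ there)
        s : Code
        s = node (ops (there (here ≡.refl))) (Vec.map h η)
        -- Where the universal formula fails, the counterexample code s refutes φ, against the
        -- instance at the preimage of s under h.
        refuted : _⊨_ model η (∀′ φ) → ¬ Large (λ t → Refutes (∀′ φ) (at η t))
        refuted f l = large-proper (to (łφ (c ∷ η)) (f c))
          (large-map₂ (λ e ¬∀ p → choose-spec (λ η x → Refutes φ (x ∷ η))
              (decidable-stable em (λ ¬∃ → ¬∀ (λ x → decidable-stable em (λ ¬p → ¬∃ (x , ¬p)))))
              (⊨-cong S-cong (Pointwise.sym sym e) φ p))
            (replace φ η (proj₂ (h-onto s))) l)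
          where
          c = proj₁ (h-onto s)
      łoś (∃′ φ)     ops η = mk⇔
        (λ (c , p) → large-map (λ q → _ , q) (to (łφ (c ∷ η)) p))
        (λ l → c , from (łφ (c ∷ η)) (large-map₂
          (λ e ∃x → ⊨-cong S-cong e φ (choose-spec (λ η x → Satisfies φ (x ∷ η)) ∃x))
          (replace φ η (proj₂ (h-onto s))) l))
        where
        łφ = łoś φ (ops ∘ there)
        s : Code
        s = node (ops (here ≡.refl)) (Vec.map h η)
        c = proj₁ (h-onto s)

-- The model with transported multiplication

module _ {ℝ : CompleteOrderedField} (F : Subfield ℝ) where
  open CompleteOrderedField ℝ
  open Quotients ℝ
  private module R = OrderedField (orderedField ℝ)

  ⟦⟧<-cong : ∀ {k} (R : OrderRelation k) {xs ys} → Pointwise _≈_ xs ys → ⟦_⟧< F R xs → ⟦_⟧< F R ys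
  ⟦⟧<-cong lt (p ∷ q ∷ []) x<y = R.<-respʳ q (R.<-respˡ p x<y)

  ℝ-add-cong : IsCongruent (ℝ-add F)
  ℝ-add-cong = record
    { isEquivalence = isEquivalence
    ; function-cong = function-cong
    ; relation-cong = ⟦⟧<-cong
    }
    where
    open RawStructure (ℝ-add F) using () renaming (⟦_⟧ᶠ to ⟦_⟧)
    function-cong : ∀ {k} (f : AddFunction (Subfield.Scalar F) k) {xs ys} →
                    Pointwise _≈_ xs ys → ⟦ f ⟧ xs ≈ ⟦ f ⟧ ys
    function-cong c0        []           = refl
    function-cong c1        []           = refl
    function-cong (scale _) (p ∷ [])     = *-congˡ p
    function-cong plus      (p ∷ q ∷ []) = +-cong p q
    function-cong minus     (p ∷ q ∷ []) = +-cong p (-‿cong q)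

  ℝ-mult-cong : IsCongruent (ℝ-mult F)
  ℝ-mult-cong = record
    { isEquivalence = isEquivalence
    ; function-cong = function-cong
    ; relation-cong = ⟦⟧<-cong
    }
    where
    open RawStructure (ℝ-mult F) using () renaming (⟦_⟧ᶠ to ⟦_⟧)
    function-cong : ∀ {k} (f : MultFunction (Subfield.Scalar F) k) {xs ys} →
                    Pointwise _≈_ xs ys → ⟦ f ⟧ xs ≈ ⟦ f ⟧ ys
    function-cong c0        []           = refl
    function-cong c1        []           = refl
    function-cong (scale _) (p ∷ [])     = *-congˡ p
    function-cong times     (p ∷ q ∷ []) = *-cong p q
    function-cong div       (p ∷ q ∷ []) = ÷-cong p q

module AxiomOperations (em : ExcludedMiddle 0ℓ) {ℝ : CompleteOrderedField} (F : Subfield ℝ) where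
  open Subfield F using (Scalar)
  module Add            = RawStructure (ℝ-add F)
  module Mult           = RawStructure (ℝ-mult F)
  module Additive       = Skolemization em ℝ {AddLanguage Scalar} Add.⟦_⟧ᶠ Add.⟦_⟧ʳ
  module Multiplicative = Skolemization em ℝ {MultLanguage Scalar} Mult.⟦_⟧ᶠ Mult.⟦_⟧ʳ

  operationsOfAxiom : ∃ (T[ F ]) → List (Operation ℝ)
  operationsOfAxiom (_ , inj₁ (τ , _)) = Additive.operationsOf τ
  operationsOfAxiom (_ , inj₂ (τ , _)) = Multiplicative.operationsOf τ

module TransportedModel (em : ExcludedMiddle 0ℓ) {ℝ : CompleteOrderedField} (F : Subfield ℝ)
  (extra : List (Operation ℝ)) where
  open GenericField em ℝ extra
  open AxiomOperations em F
  open Subfield F using (Scalar)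
  private
    module R = CompleteOrderedField ℝ
    module N = OrderedField genericField
  open Quotients ℝ

  σ ρ : Code → Code
  σ c = proj₁ (graph-total c)
  ρ c = proj₁ (graph-onto c)

  σ-graph : ∀ c → Graph c (σ c)
  σ-graph c = proj₂ (graph-total c)

  ρ-graph : ∀ c → Graph (ρ c) c
  ρ-graph c = proj₂ (graph-onto c)

  σ-ρ : ∀ c → σ (ρ c) ≈ᶜ c
  σ-ρ c = graph-cong (σ-graph (ρ c)) (ρ-graph c) N.refl

  σ-cong : ∀ {c d} → c ≈ᶜ d → σ c ≈ᶜ σ d
  σ-cong = graph-cong (σ-graph _) (σ-graph _)

  ρ-cong : ∀ {c d} → c ≈ᶜ d → ρ c ≈ᶜ ρ d
  ρ-cong = graph-reflects-≈ (ρ-graph _) (ρ-graph _)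

  constant : R.Carrier → Code
  constant a with em {∃ λ c → Large (λ t → den c t R.≈ a)}
  ... | yes (c , _) = c
  -- The default is standard, so multiplication by `constant a` commutes with the automorphism for
  -- every a.
  ... | no  _       = 0ᶜ

  constant-standard : ∀ a → Standard (constant a)
  constant-standard a with em {∃ λ c → Large (λ t → den c t R.≈ a)}
  ... | yes (_ , p) = a , p
  ... | no  _       = R.0# , large-all (λ _ → R.refl)

  -- Only the scalars that are named by a code are interpreted correctly;
  -- these include all scalars that a given derivation mentions.
  constant-≈ : ∀ {a} → (∃ λ c → Large (λ t → den c t R.≈ a)) → Large (λ t → den (constant a) t R.≈ a)
  constant-≈ {a} ∃c with em {∃ λ c → Large (λ t → den c t R.≈ a)}
  ... | yes (_ , p) = p
  ... | no  ¬∃c     = ⊥-elim (¬∃c ∃c)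

  ⟦_⟧ᵁ : ∀ {k} → UnionFunction Scalar k → Vec Code k → Code
  ⟦ c0            ⟧ᵁ []           = 0ᶜ
  ⟦ c1            ⟧ᵁ []           = 1ᶜ
  ⟦ scale (a , _) ⟧ᵁ (c ∷ [])     = constant a *ᶜ c
  ⟦ plus          ⟧ᵁ (c ∷ d ∷ []) = c +ᶜ d
  ⟦ minus         ⟧ᵁ (c ∷ d ∷ []) = c +ᶜ (-ᶜ d)
  ⟦ times         ⟧ᵁ (c ∷ d ∷ []) = ρ (σ c *ᶜ σ d)
  ⟦ div           ⟧ᵁ (c ∷ d ∷ []) = ρ (σ c ÷ᶜ σ d)

  ⟦_⟧ᴼ : ∀ {k} → OrderRelation k → Vec Code k → Set
  ⟦ lt ⟧ᴼ (c ∷ d ∷ []) = c <ᶜ d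

  transported : RawStructure (UnionLanguage Scalar)
  transported = record { Carrier = Code ; _≈_ = _≈ᶜ_ ; ⟦_⟧ᶠ = ⟦_⟧ᵁ ; ⟦_⟧ʳ = ⟦_⟧ᴼ }

  transported-cong : IsCongruent transported
  transported-cong = record
    { isEquivalence = N.isEquivalence
    ; function-cong = function-cong
    ; relation-cong = λ { lt (p ∷ q ∷ []) c<d → N.<-respʳ q (N.<-respˡ p c<d) }
    }
    where
    function-cong : ∀ {k} (f : UnionFunction Scalar k) {cs ds} →
                    Pointwise _≈ᶜ_ cs ds → ⟦ f ⟧ᵁ cs ≈ᶜ ⟦ f ⟧ᵁ ds
    function-cong c0        []           = N.refl
    function-cong c1        []           = N.refl
    function-cong (scale _) (p ∷ [])     = N.*-congˡ p
    function-cong plus      (p ∷ q ∷ []) = N.+-cong p q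
    function-cong minus     (p ∷ q ∷ []) = N.+-cong p (N.-‿cong q)
    function-cong times     (p ∷ q ∷ []) = ρ-cong (N.*-cong (σ-cong p) (σ-cong q))
    function-cong div       (p ∷ q ∷ []) = ρ-cong (≈ᶜ-map₂ ÷-cong (σ-cong p) (σ-cong q))

  -- A listed scaling g gives its scalar a name, namely the code for g applied to 1.
  named : ∀ {a} {g : Vec R.Carrier 1 → R.Carrier} → (∀ x → g (x ∷ []) R.≈ a R.* x) →
          (1 , g) ∈ operations → Large (λ t → den (constant a) t R.≈ a)
  named {a} g≈ p = constant-≈ (node p (1ᶜ ∷ []) , large-all (λ _ → R.trans (g≈ R.1#) (R.*-identityʳ a)))

  additive-function : ∀ {k} (f : AddFunction Scalar k) → (k , Add.⟦ f ⟧ᶠ) ∈ operations → ∀ cs →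
    Large (λ t → den (⟦ _↪_.onFunction add↪ f ⟧ᵁ cs) t R.≈ Add.⟦ f ⟧ᶠ (dens (Vec.map (λ c → c) cs) t))
  additive-function c0        _ []           = large-all λ _ → R.refl
  additive-function c1        _ []           = large-all λ _ → R.refl
  additive-function (scale a) p (c ∷ [])     = large-map R.*-congʳ (named (λ _ → R.refl) p)
  additive-function plus      _ (c ∷ d ∷ []) = large-all λ _ → R.refl
  additive-function minus     _ (c ∷ d ∷ []) = large-all λ _ → R.refl

  additive-relation : ∀ {k} (R : OrderRelation k) cs →
    ⟦ _↪_.onRelation (add↪ {Scalar}) R ⟧ᴼ cs ⇔ Large (λ t → Add.⟦ R ⟧ʳ (dens (Vec.map (λ c → c) cs) t))
  additive-relation lt (c ∷ d ∷ []) = mk⇔ large-< eventually-<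

  module AdditiveŁoś = Additive.Łoś.Representation (ℝ-add-cong F) extra
    (λ f → ⟦ _↪_.onFunction add↪ f ⟧ᵁ) (λ R → ⟦ _↪_.onRelation (add↪ {Scalar}) R ⟧ᴼ)
    (λ c → c) (λ c → c , N.refl) (⇔-id _) additive-function additive-relation

  multiplicative-function : ∀ {k} (f : MultFunction Scalar k) → (k , Mult.⟦ f ⟧ᶠ) ∈ operations → ∀ cs →
    Large (λ t → den (σ (⟦ _↪_.onFunction mult↪ f ⟧ᵁ cs)) t R.≈ Mult.⟦ f ⟧ᶠ (dens (Vec.map σ cs) t))
  multiplicative-function c0        _ []           = large-≈ (graph-cong (σ-graph 0ᶜ) graph-0 N.refl)
  multiplicative-function c1        _ []           = large-≈ (graph-cong (σ-graph 1ᶜ) graph-1 N.refl)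
  multiplicative-function (scale (a , _)) p (c ∷ [])     = large-map₂ R.trans
    (large-≈ (graph-cong (σ-graph (constant a *ᶜ c)) (graph-scale (constant-standard a) (σ-graph c)) N.refl))
    (large-map R.*-congʳ (named (λ _ → R.refl) p))
  multiplicative-function times     _ (c ∷ d ∷ []) = large-≈ (σ-ρ (σ c *ᶜ σ d))
  multiplicative-function div       _ (c ∷ d ∷ []) = large-≈ (σ-ρ (σ c ÷ᶜ σ d))

  multiplicative-relation : ∀ {k} (R : OrderRelation k) cs →
    ⟦ _↪_.onRelation (mult↪ {Scalar}) R ⟧ᴼ cs ⇔ Large (λ t → Mult.⟦ R ⟧ʳ (dens (Vec.map σ cs) t))
  multiplicative-relation lt (c ∷ d ∷ []) = mk⇔
    (λ c<d → large-< (graph-mono (σ-graph c) (σ-graph d) c<d))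
    (λ l → graph-reflects-< (σ-graph c) (σ-graph d) (eventually-< l))

  module MultiplicativeŁoś = Multiplicative.Łoś.Representation (ℝ-mult-cong F) extra
    (λ f → ⟦ _↪_.onFunction mult↪ f ⟧ᵁ) (λ R → ⟦ _↪_.onRelation (mult↪ {Scalar}) R ⟧ᴼ)
    σ (λ c → ρ c , σ-ρ c) (mk⇔ σ-cong (graph-reflects-≈ (σ-graph _) (σ-graph _)))
    multiplicative-function multiplicative-relation

  -- A true sentence has no free variables, so it is true at every t. The model in each instance of
  -- Łoś is definitionally a reduct of `transported`, the multiplicative one being read through σ.
  axiom-holds : ∀ (α : ∃ (T[ F ])) → operationsOfAxiom α ⊆ˡ operations → Th transported (proj₁ α)
  axiom-holds (_ , inj₁ (τ , τ-true , ≡.refl)) ops =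
    to (⊨-translate add↪ transported [] τ) (from (AdditiveŁoś.łoś τ ops []) (large-all λ _ → τ-true))
  axiom-holds (_ , inj₂ (τ , τ-true , ≡.refl)) ops =
    to (⊨-translate mult↪ transported [] τ) (from (MultiplicativeŁoś.łoś τ ops []) (large-all λ _ → τ-true))

module Unprovability (em : ExcludedMiddle 0ℓ) {ℝ : CompleteOrderedField} (F : Subfield ℝ)
  (r : CompleteOrderedField.Carrier ℝ) (θ : Formula (UnionLanguage (Subfield.Scalar F)) 1)
  (d : T[ F ] ⊢ ∀′ (θ ⇒′ var (# 0) ⊗ var (# 0) ⊖ f[ two F ] (var (# 0)) ⊕ 𝟙 ≽ 𝟘)) where
  open AxiomOperations em F

  -- The constant r is added because no axiom of the derivation need mention it, and the premise θ
  -- is evaluated with its true value.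
  usedOperations : List (Operation ℝ)
  usedOperations = (0 , λ _ → r) ∷ List.concat (List.map operationsOfAxiom (axiomsOf d))

  open TransportedModel em F usedOperations public
  open GenericField em ℝ usedOperations public
  private
    module R = OrderedField (orderedField ℝ)
    module N = OrderedField genericField

  refuted : ∀ {e} → Infinitesimal e → ¬ e ≈ᶜ 0ᶜ → ¬ _⊨_ transported ((1ᶜ +ᶜ e) ∷ []) θ
  refuted {e} inf-e e≉0 premise = OrderedFieldProperties.double-negative genericField
    (transported-square inf-e e≉0 (σ-graph _) (ρ-graph _))
    -- The scalar 2 always has a name, even if no axiom in the derivation contains its function
    -- symbol.
    (eventually-≈ (constant-≈ (1ᶜ +ᶜ 1ᶜ , large-all (λ _ → R.refl))))
    (sound em transported-cong d
      (All.tabulate λ {α} α∈ → axiom-holds α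
        (λ o∈ → extra∈ (there (∈-concat⁺′ o∈ (∈-map⁺ operationsOfAxiom α∈)))))
      [] [] (1ᶜ +ᶜ e) premise)

  r-constant : constant r *ᶜ 1ᶜ ≈ᶜ node (extra∈ (here ≡.refl)) []
  r-constant = N.trans (N.*-identityʳ _) (eventually-≈ (constant-≈
    (node (extra∈ (here ≡.refl)) [] , large-all (λ _ → R.refl))))

  generic≉0 : ¬ generic ≈ᶜ 0ᶜ
  generic≉0 t≈0 = N.<-irrefl (N.sym t≈0) generic-pos

-- The negative half

module _ (em : ExcludedMiddle 0ℓ) {ℝ : CompleteOrderedField} (F : Subfield ℝ)
  (r : CompleteOrderedField.Carrier ℝ) (r∈F : Subfield.Member F r) where
  open CompleteOrderedField ℝ
  private
    module R = OrderedField (orderedField ℝ)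
    open OrderedFieldProperties (orderedField ℝ)

  -- If r ≥ 1, the counterexample is x = 1 - t with t the generic infinitesimal, as then x < r.
  provable-below⇒r<1 : T[ F ] ⊢ ∀′ (var (# 0) ≼ const (r , r∈F) ⇒′
                          var (# 0) ⊗ var (# 0) ⊖ f[ two F ] (var (# 0)) ⊕ 𝟙 ≽ 𝟘) → r < 1#
  provable-below⇒r<1 d = decidable-stable (r <? 1#) λ r≮1 →
    refuted (infinitesimal-neg generic-infinitesimal)
      (λ -t≈0 → generic≉0 (eventually-≈ (large-map
        (λ {t} e → trans (solve 1 (λ t → t := :- (:- t)) refl t)
          (trans (-‿cong e) (solve 0 (:- con (+ 0) := con (+ 0)) refl)))
        (large-≈ -t≈0))))
      (inj₁ (eventually-< (large-map₂
        (λ {t} 0<t r≈ → R.<-respʳ (sym r≈) (below 0<t r≮1)) (large-< generic-pos) (large-≈ r-constant))))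
    where
    open Unprovability em F r _ d
    below : ∀ {t} → 0# < t → ¬ r < 1# → 1# - t < r
    below {t} 0<t r≮1 with R.compare 1# r
    ... | tri< 1<r _ _ = R.<-trans 1-t<1 1<r
      where
      1-t<1 = certify 0<t (solve 1 (λ t → t := con (+ 1) :- (con (+ 1) :- t)) refl t)
    ... | tri≈ _ 1≈r _ = R.<-respʳ 1≈r
            (certify 0<t (solve 1 (λ t → t := con (+ 1) :- (con (+ 1) :- t)) refl t))
    ... | tri> _ _ r<1 = ⊥-elim (r≮1 r<1)

  -- If r ≤ 1, the counterexample is x = 1 + t, on the other side of 1.
  provable-above⇒r>1 : T[ F ] ⊢ ∀′ (var (# 0) ≽ const (r , r∈F) ⇒′
                          var (# 0) ⊗ var (# 0) ⊖ f[ two F ] (var (# 0)) ⊕ 𝟙 ≽ 𝟘) → r > 1#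
  provable-above⇒r>1 d = decidable-stable (1# <? r) λ 1≮r →
    refuted generic-infinitesimal generic≉0
      (inj₁ (eventually-< (large-map₂
        (λ {t} 0<t r≈ → R.<-respˡ (sym r≈) (above 0<t 1≮r)) (large-< generic-pos) (large-≈ r-constant))))
    where
    open Unprovability em F r _ d
    above : ∀ {t} → 0# < t → ¬ 1# < r → r < 1# + t
    above {t} 0<t 1≮r with R.compare 1# r
    ... | tri< 1<r _ _ = ⊥-elim (1≮r 1<r)
    ... | tri≈ _ 1≈r _ = R.<-respˡ 1≈r
            (certify 0<t (solve 1 (λ t → t := con (+ 1) :+ t :- con (+ 1)) refl t))
    ... | tri> _ _ r<1 = R.<-trans r<1
            (certify 0<t (solve 1 (λ t → t := con (+ 1) :+ t :- con (+ 1)) refl t))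

-- Derivations

module OrderedFieldNonnegativity (K : OrderedField) where
  open OrderedField K
  open OrderedFieldProperties K

  ≤-respʳ : ∀ {x y z} → y ≈ z → x ≤ y → x ≤ z
  ≤-respʳ y≈z (inj₁ x<y) = inj₁ (<-respʳ y≈z x<y)
  ≤-respʳ y≈z (inj₂ x≈y) = inj₂ (trans x≈y y≈z)

  ≤-respˡ : ∀ {x y z} → y ≈ z → y ≤ x → z ≤ x
  ≤-respˡ y≈z (inj₁ y<x) = inj₁ (<-respˡ y≈z y<x)
  ≤-respˡ y≈z (inj₂ y≈x) = inj₂ (trans (sym y≈z) y≈x)

  nonneg-+ : ∀ {x y} → 0# ≤ x → 0# ≤ y → 0# ≤ x + y
  nonneg-+ (inj₁ 0<x) 0≤y = inj₁ (+-pos-nonneg 0<x 0≤y)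
  nonneg-+ (inj₂ 0≈x) 0≤y = ≤-respʳ (trans (sym (+-identityˡ _)) (+-congʳ 0≈x)) 0≤y

  nonneg-* : ∀ {x y} → 0# ≤ x → 0# ≤ y → 0# ≤ x * y
  nonneg-* (inj₁ 0<x) (inj₁ 0<y) = inj₁ (*-pos 0<x 0<y)
  nonneg-* (inj₁ 0<x) (inj₂ 0≈y) = inj₂ (sym (trans (*-congˡ (sym 0≈y)) (zeroʳ _)))
  nonneg-* (inj₂ 0≈x) 0≤y        = inj₂ (sym (trans (*-congʳ (sym 0≈x)) (zeroˡ _)))

  nonneg-difference : ∀ {x y} → x ≤ y → 0# ≤ y - x
  nonneg-difference     (inj₁ x<y) = inj₁ (positive-difference x<y)
  nonneg-difference {x} (inj₂ x≈y) = inj₂ (trans (sym (-‿inverseʳ x)) (+-congʳ x≈y))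

  certify-≤ : ∀ {p x y} → 0# ≤ p → p ≈ y - x → x ≤ y
  certify-≤ (inj₁ 0<p) p≈y-x = inj₁ (certify 0<p p≈y-x)
  certify-≤ {p} {x} {y} (inj₂ 0≈p) p≈y-x = inj₂
    (trans (solve 2 (λ x y → x := y :+ (:- con (+ 1)) :* (y :- x :- con (+ 0))) refl x y)
      (absorb (- 1#) (trans (sym p≈y-x) (sym 0≈p))))

  ≤-or-> : ∀ x y → x ≤ y ⊎ y < x
  ≤-or-> x y with compare x y
  ... | tri< x<y _ _ = inj₁ (inj₁ x<y)
  ... | tri≈ _ x≈y _ = inj₁ (inj₂ x≈y)
  ... | tri> _ _ y<x = inj₂ y<x

  ≤⇒≯ : ∀ {x y} → x ≤ y → ¬ y < x
  ≤⇒≯ (inj₁ x<y) y<x = <-irrefl refl (<-trans x<y y<x)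
  ≤⇒≯ (inj₂ x≈y) y<x = <-irrefl (sym x≈y) y<x

module Archimedean (em : ExcludedMiddle 0ℓ) (ℝ : CompleteOrderedField) where
  open CompleteOrderedField ℝ
  open OrderedFieldProperties (orderedField ℝ)
  open OrderedFieldNonnegativity (orderedField ℝ)
  private module R = OrderedField (orderedField ℝ)

  infixr 8 _·_

  _·_ : ℕ → Carrier → Carrier
  zero  · s = 0#
  suc n · s = s + n · s

  ·-cong : ∀ n {s t} → s ≈ t → n · s ≈ n · t
  ·-cong zero    s≈t = refl
  ·-cong (suc n) s≈t = +-cong s≈t (·-cong n s≈t)

  ·-scale : ∀ n k s → n · (k * s) ≈ k * n · s
  ·-scale zero    k s = sym (zeroʳ k)
  ·-scale (suc n) k s = trans (+-congˡ (·-scale n k s)) (sym (distribˡ k s _))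

  -- Otherwise the multiples of s have a supremum u; as the next multiple is also at most u, even u
  -- - s is an upper bound.
  archimedean : ∀ {s} → 0# < s → ∃ λ n → 1# ≤ n · s
  archimedean {s} 0<s with em {∃ λ n → 1# ≤ n · s}
  ... | yes ∃n = ∃n
  ... | no ¬∃n with complete (λ x → ∃ λ n → x ≈ n · s) (0# , 0 , refl) (1# , λ (n , x≈ns) → bounded n x≈ns)
    where
    bounded : ∀ n {x} → x ≈ n · s → x ≤ 1#
    bounded n {x} x≈ns with ≤-or-> x 1#
    ... | inj₁ x≤1 = x≤1
    ... | inj₂ 1<x = ⊥-elim (¬∃n (n , inj₁ (R.<-respʳ x≈ns 1<x)))
  ...   | u , upper , least = ⊥-elim (≤⇒≯ (least {u - s} λ (n , x≈ns) → shift n x≈ns) (certify 0<s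
            (solve 2 (λ u s → s := u :- (u :- s)) refl u s)))
    where
    shift : ∀ n {x} → x ≈ n · s → x ≤ u - s
    shift n {x} x≈ns = certify-≤ (nonneg-difference (upper (suc n , refl)))
      (trans (solve 3 (λ u s ns → u :- (s :+ ns) := u :- s :- ns) refl u s (n · s))
             (+-congˡ (-‿cong (sym x≈ns))))

infix 8 _≤ᶠ_
-- Serves both languages, and its translation into the union is definitionally `≼`.
_≤ᶠ_ : ∀ {Function : ℕ → Set} {n} (s t : Term (record { Function = Function ; Relation = OrderRelation }) n) →
       Formula (record { Function = Function ; Relation = OrderRelation }) n
s ≤ᶠ t = rel lt (s ∷ t ∷ []) ∨′ s ≐ t

module Provability {ℝ : CompleteOrderedField} (F : Subfield ℝ) where
  open CompleteOrderedField ℝ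
  open Subfield F
  open OrderedFieldProperties (orderedField ℝ)
  open OrderedFieldNonnegativity (orderedField ℝ)
  private module R = OrderedField (orderedField ℝ)

  Union : Set
  Union = Formula (UnionLanguage Scalar) 1

  x : Term (UnionLanguage Scalar) 1
  x = var (# 0)

  goal : Union
  goal = x ⊗ x ⊖ f[ two F ] x ⊕ 𝟙 ≽ 𝟘

  -- The only fact about x² that passes from the multiplicative to the additive theory: a linear
  -- lower bound.
  tangent : Scalar → Union
  tangent a = f[ a ] x ≼ x ⊗ x

  -- Quantifying over the context spares a weakening lemma for derivations.
  Derivable : Union → Set
  Derivable φ = ∀ Γ → T[ F ] ∣ Γ ⊢ φ

  chain : ∀ {φ ψ χ} → Derivable (φ ⇒′ ψ ∨′ χ) → Derivable (ψ ⇒′ goal) → Derivable (χ ⇒′ goal) →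
          Derivable (φ ⇒′ goal)
  chain d e f Γ = ⇒-i (∨-e (⇒-e (d _) (hyp (here ≡.refl)))
    (⇒-e (e _) (hyp (here ≡.refl))) (⇒-e (f _) (hyp (here ≡.refl))))

  ex-falso : ∀ {φ} → Derivable (⊥′ ⇒′ φ)
  ex-falso Γ = ⇒-i (raa (hyp (there (here ≡.refl))))

  module _ {n : ℕ} where
    constᵃ : Scalar → Term (AddLanguage Scalar) n
    constᵃ a = app (scale a) (app c1 [] ∷ [])

    constᵐ : Scalar → Term (MultLanguage Scalar) n
    constᵐ a = app (scale a) (app c1 [] ∷ [])

  xᵐ : Term (MultLanguage Scalar) 1
  xᵐ = var (# 0)

  xᵃ yᵃ : Term (AddLanguage Scalar) 2
  xᵃ = var (# 1)
  yᵃ = var (# 0)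

  tangentᵐ : Scalar → Formula (MultLanguage Scalar) 1
  tangentᵐ a = app (scale a) (xᵐ ∷ []) ≤ᶠ app times (xᵐ ∷ xᵐ ∷ [])

  -- In the additive language y stands for x².
  tangentᵃ : Scalar → Formula (AddLanguage Scalar) 2
  tangentᵃ a = app (scale a) (xᵃ ∷ []) ≤ᶠ yᵃ

  goalᵃ : Formula (AddLanguage Scalar) 2
  goalᵃ = app c0 [] ≤ᶠ app plus (app minus (yᵃ ∷ app (scale (two F)) (xᵃ ∷ []) ∷ []) ∷ app c1 [] ∷ [])

  multiplicative : ∀ {τ : Formula (MultLanguage Scalar) 0} → Th (ℝ-mult F) τ →
                   ∀ {n} {Γ : List (Formula (UnionLanguage Scalar) n)} → T[ F ] ∣ Γ ⊢ translate mult↪ τ /ᶠ []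
  multiplicative {τ} p = axiom (inj₂ (τ , p , ≡.refl))

  additive : ∀ {τ : Formula (AddLanguage Scalar) 0} → Th (ℝ-add F) τ →
             ∀ {n} {Γ : List (Formula (UnionLanguage Scalar) n)} → T[ F ] ∣ Γ ⊢ translate add↪ τ /ᶠ []
  additive {τ} p = axiom (inj₁ (τ , p , ≡.refl))

  unit-≤ : ∀ {a b} → a ≤ b * 1# → a ≤ b
  unit-≤ = ≤-respʳ (*-identityʳ _)

  ≤-unit : ∀ {a b} → a ≤ b → a ≤ b * 1#
  ≤-unit = ≤-respʳ (sym (*-identityʳ _))

  unit-≥ : ∀ {a b} → b * 1# ≤ a → b ≤ a
  unit-≥ = ≤-respˡ (*-identityʳ _)

  ≥-unit : ∀ {a b} → b ≤ a → b * 1# ≤ a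
  ≥-unit = ≤-respˡ (sym (*-identityʳ _))

  tangent-true : ∀ {a x} → 0# ≤ x → a ≤ x → a * x ≤ x * x
  tangent-true {a} {x} 0≤x a≤x = certify-≤ (nonneg-* 0≤x (nonneg-difference a≤x))
    (solve 2 (λ a x → x :* (x :- a) := x :* x :- a :* x) refl a x)

  module _ (a b : Scalar) where
    private
      a′ b′ : Carrier
      a′ = proj₁ a
      b′ = proj₁ b

    -- The order belongs to both languages, so one multiplicative sentence can both split at a and
    -- bound x². The bound `x ≼ const b` is repeated for the additive argument that follows.
    lower-step : 0# ≤ a′ → Derivable (x ≼ const b ⇒′ x ≼ const a ∨′ (x ≼ const b ∧′ tangent a))
    lower-step 0≤a Γ = ∀-e x (multiplicative
      {∀′ (xᵐ ≤ᶠ constᵐ b ⇒′ xᵐ ≤ᶠ constᵐ a ∨′ (xᵐ ≤ᶠ constᵐ b ∧′ tangentᵐ a))} holds)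
      where
      holds : ∀ x → x ≤ b′ * 1# → x ≤ a′ * 1# ⊎ (x ≤ b′ * 1# × a′ * x ≤ x * x)
      holds x x≤b = Sum.map ≤-unit (λ a<x → x≤b , tangent-true (≤-<-nonneg 0≤a a<x) (inj₁ a<x)) (≤-or-> x a′)
        where
        ≤-<-nonneg : 0# ≤ a′ → a′ < x → 0# ≤ x
        ≤-<-nonneg (inj₁ 0<a) a<x = inj₁ (R.<-trans 0<a a<x)
        ≤-<-nonneg (inj₂ 0≈a) a<x = inj₁ (R.<-respˡ (sym 0≈a) a<x)

    upper-step : 0# < b′ → Derivable (x ≽ const b ⇒′ x ≽ const a ∨′ (x ≼ const a ∧′ tangent b))
    upper-step 0<b Γ = ∀-e x (multiplicative
      {∀′ (constᵐ b ≤ᶠ xᵐ ⇒′ constᵐ a ≤ᶠ xᵐ ∨′ (xᵐ ≤ᶠ constᵐ a ∧′ tangentᵐ b))} holds)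
      where
      holds : ∀ x → b′ * 1# ≤ x → a′ * 1# ≤ x ⊎ (x ≤ a′ * 1# × b′ * x ≤ x * x)
      holds x b≤x = Sum.map ≥-unit
        (λ x<a → ≤-unit (inj₁ x<a) , tangent-true (positive (unit-≥ b≤x)) (unit-≥ b≤x)) (≤-or-> a′ x)
        where
        positive : b′ ≤ x → 0# ≤ x
        positive (inj₁ b<x) = inj₁ (R.<-trans 0<b b<x)
        positive (inj₂ b≈x) = inj₁ (R.<-respʳ b≈x 0<b)

    -- The additive sentence is universal in y and is instantiated with `x ⊗ x`. It holds as y - 2x
    -- + 1 is the sum of y - a x, (2 - a) (b - x) and 1 - (2 - a) b, all nonnegative.
    tangent⇒goal : a′ ≤ 1# + 1# → (1# + 1# - a′) * b′ ≤ 1# → Derivable (x ≼ const b ∧′ tangent a ⇒′ goal)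
    tangent⇒goal a≤2 [2-a]b≤1 Γ = ∀-e (x ⊗ x) (∀-e x (additive
      {∀′ (∀′ (xᵃ ≤ᶠ constᵃ b ∧′ tangentᵃ a ⇒′ goalᵃ))} holds))
      where
      holds : ∀ x y → x ≤ b′ * 1# × a′ * x ≤ y → 0# ≤ y - (1# + 1#) * x + 1#
      holds x y (x≤b , ax≤y) = ≤-respʳ
        (solve 4 (λ a b x y → let two = con (+ 2) in
          y :- a :* x :+ (two :- a) :* (b :- x) :+ (con (+ 1) :- (two :- a) :* b)
          := y :- two :* x :+ con (+ 1)) refl a′ b′ x y)
        (nonneg-+ (nonneg-+ (nonneg-difference ax≤y)
          (nonneg-* (nonneg-difference a≤2) (nonneg-difference (unit-≤ x≤b)))) (nonneg-difference [2-a]b≤1))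

  lower-base : ∀ b → (1# + 1#) * proj₁ b ≤ 1# → Derivable (x ≼ const b ⇒′ goal)
  lower-base b 2b≤1 = chain
    -- The slope 0 bounds x² for negative x as well, so no case remains; the disjunct `⊥′` only
    -- gives the sentence the form that `chain` expects.
    (λ Γ → ∀-e x (multiplicative {∀′ (xᵐ ≤ᶠ constᵐ b ⇒′ ⊥′ ∨′ (xᵐ ≤ᶠ constᵐ b ∧′ tangentᵐ (0# , 0-closed)))}
      (λ x x≤b → inj₂ (x≤b , certify-≤ (square-nonneg x)
        (solve 1 (λ x → x :* x := x :* x :- con (+ 0) :* x) refl x)))))
    ex-falso
    (tangent⇒goal (0# , 0-closed) b (inj₁ 0<2) (certify-≤ (nonneg-difference 2b≤1)
      (solve 1 (λ b → con (+ 1) :- con (+ 2) :* b := con (+ 1) :- (con (+ 2) :- con (+ 0)) :* b) refl (proj₁ b))))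

  upper-base : ∀ b → 1# + 1# ≤ proj₁ b → Derivable (x ≽ const b ⇒′ goal)
  upper-base b@(b′ , _) 2≤b = chain
    (λ Γ → ∀-e x (multiplicative {∀′ (constᵐ b ≤ᶠ xᵐ ⇒′ ⊥′ ∨′ (constᵐ b ≤ᶠ xᵐ ∧′ tangentᵐ b))}
      (λ x b≤x → inj₂ (b≤x , tangent-true
        (≤-respʳ (solve 2 (λ b x → con (+ 2) :+ (b :- con (+ 2)) :+ (x :- b) := x) refl b′ x)
          (nonneg-+ (nonneg-+ (inj₁ 0<2) (nonneg-difference 2≤b)) (nonneg-difference (unit-≥ b≤x))))
        (unit-≥ b≤x)))))
    ex-falso
    (λ Γ → ∀-e (x ⊗ x) (∀-e x (additive {∀′ (∀′ (constᵃ b ≤ᶠ xᵃ ∧′ tangentᵃ b ⇒′ goalᵃ))} holds)))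
    where
    holds : ∀ x y → b′ * 1# ≤ x × b′ * x ≤ y → 0# ≤ y - (1# + 1#) * x + 1#
    holds x y (b≤x , bx≤y) = ≤-respʳ
      -- For b ≥ 2 the line b x lies above 2x - 1 on all of x ≥ b, so this last piece needs no right
      -- end point.
      (solve 3 (λ b x y → let two = con (+ 2); c = b :- two in
        y :- b :* x :+ c :* (x :- b) :+ c :* (c :+ two) :+ con (+ 1)
        := y :- two :* x :+ con (+ 1)) refl b′ x y)
      (nonneg-+ (nonneg-+ (nonneg-+ (nonneg-difference bx≤y) (nonneg-* 0≤b-2 (nonneg-difference (unit-≥ b≤x))))
        (nonneg-* 0≤b-2 (nonneg-+ 0≤b-2 (inj₁ 0<2)))) (inj₁ 0<1))
      where
      0≤b-2 = nonneg-difference 2≤b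

-- Chains of intervals and the positive half

module _ (em : ExcludedMiddle 0ℓ) {ℝ : CompleteOrderedField} (F : Subfield ℝ) where
  open CompleteOrderedField ℝ
  open Subfield F
  open OrderedFieldProperties (orderedField ℝ)
  open OrderedFieldNonnegativity (orderedField ℝ)
  open Archimedean em ℝ
  open Provability F
  private module R = OrderedField (orderedField ℝ)

  private
    1≰0 : ¬ 1# ≤ 0#
    1≰0 1≤0 = ≤⇒≯ 1≤0 0<1

    -- Here s is the distance of r from 1, and w s that of the next end point. As w = 1 / (1 - s),
    -- the reciprocal of w s is 1 / s - 1, so a bound n + 1 on the reciprocal becomes n.
    advance : ∀ n {p w s} → p * w ≈ 1# → 0# < w → p ≈ 1# - s → 1# ≤ suc n · s → 1# ≤ n · (w * s)
    advance n {p} {w} {s} pw≈1 0<w p≈1-s 1≤ = certify-≤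
      (nonneg-* (inj₁ 0<w) (nonneg-difference 1≤))
      (trans (solve 4 (λ p w s ns →
          w :* (s :+ ns :- con (+ 1)) := w :* ns :- con (+ 1) :+ (:- con (+ 1)) :* (p :* w :- con (+ 1))
            :+ w :* (p :- (con (+ 1) :- s))) refl p w s (n · s))
        (trans (absorb _ p≈1-s) (trans (absorb _ pw≈1) (+-congʳ (sym (·-scale n w s))))))

  -- Induction on a bound n for 1 / (1 - r). Each step descends from r to the left end of its
  -- interval, until r ≤ 1/2.
  derive-below : ∀ n (r : Scalar) → proj₁ r < 1# → 1# ≤ n · (1# - proj₁ r) → Derivable (x ≼ const r ⇒′ goal)
  derive-below zero    r            _   1≤ = ⊥-elim (1≰0 1≤)
  derive-below (suc n) r@(r′ , r∈F) r<1 1≤ = Sum.[ lower-base r , step ]′ (≤-or-> ((1# + 1#) * r′) 1#)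
    where
    step : 1# < (1# + 1#) * r′ → Derivable (x ≼ const r ⇒′ goal)
    step 1<2r = chain (lower-step a r (inj₁ 0<a))
      (derive-below n a a<1 (≤-respʳ (·-cong n 1-a≈) (advance n rw≈1 0<w
        (solve 1 (λ r → r := con (+ 1) :- (con (+ 1) :- r)) refl r′) 1≤)))
      (tangent⇒goal a r (inj₁ (certify 0<w (solve 1 (λ w → w := con (+ 2) :- (con (+ 2) :- w)) refl w)))
        (inj₂ (trans (solve 2 (λ r w → (con (+ 2) :- (con (+ 2) :- w)) :* r := r :* w) refl r′ w) rw≈1)))
      where
      0<r : 0# < r′
      0<r = pos-cancelˡ 0<2 (R.<-trans 0<1 1<2r)
      w : Carrier
      w = proj₁ (R.inverse r′ (<⇒≉ 0<r))
      rw≈1 : r′ * w ≈ 1#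
      rw≈1 = proj₂ (R.inverse r′ (<⇒≉ 0<r))
      0<w : 0# < w
      0<w = pos-cancelˡ 0<r (R.<-respʳ (sym rw≈1) 0<1)
      -- The solution of r = 1 / (2 - a). It is positive because 2r > 1, as `lower-step` requires.
      a : Scalar
      a = 1# + 1# - w , +-closed (+-closed 1-closed 1-closed) (neg-closed (inv-closed r∈F rw≈1))
      0<a : 0# < proj₁ a
      0<a = pos-cancelˡ 0<r (R.<-respʳ (trans
        (solve 2 (λ r w → con (+ 2) :* r :- con (+ 1)
          := r :* (con (+ 2) :- w) :+ con (+ 1) :* (r :* w :- con (+ 1))) refl r′ w)
        (absorb 1# rw≈1)) (positive-difference 1<2r))
      1-a≈ : w * (1# - r′) ≈ 1# - proj₁ a
      1-a≈ = trans (solve 2 (λ r w → w :* (con (+ 1) :- r)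
          := con (+ 1) :- (con (+ 2) :- w) :+ (:- con (+ 1)) :* (r :* w :- con (+ 1))) refl r′ w)
        (absorb (- 1#) rw≈1)
      a<1 : proj₁ a < 1#
      a<1 = certify (*-pos 0<w (positive-difference r<1)) 1-a≈

  -- The mirror image: r is now the left end of the interval, the right end 1 / (2 - r) is farther
  -- from 1, and the induction stops once r ≥ 2.
  derive-above : ∀ n (r : Scalar) → 1# < proj₁ r → 1# ≤ n · (proj₁ r - 1#) → Derivable (x ≽ const r ⇒′ goal)
  derive-above zero    r            _   1≤ = ⊥-elim (1≰0 1≤)
  derive-above (suc n) r@(r′ , r∈F) 1<r 1≤ = Sum.[ upper-base r , step ]′ (≤-or-> (1# + 1#) r′)
    where
    step : r′ < 1# + 1# → Derivable (x ≽ const r ⇒′ goal)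
    step r<2 = chain (upper-step a r (R.<-trans 0<1 1<r))
      (derive-above n a 1<a (≤-respʳ (·-cong n a-1≈) (advance n pw≈1 0<w
        (solve 1 (λ r → con (+ 2) :- r := con (+ 1) :- (r :- con (+ 1))) refl r′) 1≤)))
      (tangent⇒goal r a (inj₁ r<2) (inj₂ pw≈1))
      where
      p : Carrier
      p = 1# + 1# - r′
      0<p : 0# < p
      0<p = positive-difference r<2
      w : Carrier
      w = proj₁ (R.inverse p (<⇒≉ 0<p))
      pw≈1 : p * w ≈ 1#
      pw≈1 = proj₂ (R.inverse p (<⇒≉ 0<p))
      0<w : 0# < w
      0<w = pos-cancelˡ 0<p (R.<-respʳ (sym pw≈1) 0<1)
      a : Scalar
      a = w , inv-closed (+-closed (+-closed 1-closed 1-closed) (neg-closed r∈F)) pw≈1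
      a-1≈ : w * (r′ - 1#) ≈ w - 1#
      a-1≈ = trans (solve 2 (λ r w → w :* (r :- con (+ 1))
          := w :- con (+ 1) :+ (:- con (+ 1)) :* ((con (+ 2) :- r) :* w :- con (+ 1))) refl r′ w)
        (absorb (- 1#) pw≈1)
      1<a : 1# < w
      1<a = certify (*-pos 0<w (positive-difference 1<r)) a-1≈

  r<1⇒provable-below : ∀ r (r∈F : Member r) → r < 1# → T[ F ] ⊢ ∀′ (x ≼ const (r , r∈F) ⇒′ goal)
  r<1⇒provable-below r r∈F r<1 =
    let (n , 1≤) = archimedean (positive-difference r<1) in ∀-i (derive-below n (r , r∈F) r<1 1≤ [])

  r>1⇒provable-above : ∀ r (r∈F : Member r) → r > 1# → T[ F ] ⊢ ∀′ (x ≽ const (r , r∈F) ⇒′ goal)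
  r>1⇒provable-above r r∈F r>1 =
    let (n , 1≤) = archimedean (positive-difference r>1) in ∀-i (derive-above n (r , r∈F) r>1 1≤ [])

theorem5p3 : ExcludedMiddle 0ℓ →
    (ℝ : CompleteOrderedField) (F : Subfield ℝ) →
    let open CompleteOrderedField ℝ in
    let open Subfield F in
    (r : Carrier) (r∈F : Member r) →
    let x = var (# 0) in
    let r′ = const (r , r∈F) in
    (T[ F ] ⊢ ∀′ (x ≼ r′ ⇒′ x ⊗ x ⊖ f[ two F ] x ⊕ 𝟙 ≽ 𝟘) ⇔ r < 1#) ×
    (T[ F ] ⊢ ∀′ (x ≽ r′ ⇒′ x ⊗ x ⊖ f[ two F ] x ⊕ 𝟙 ≽ 𝟘) ⇔ r > 1#)
theorem5p3 em ℝ F r r∈F =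
  mk⇔ (provable-below⇒r<1 em F r r∈F) (r<1⇒provable-below em F r r∈F) ,
  mk⇔ (provable-above⇒r>1 em F r r∈F) (r>1⇒provable-above em F r r∈F)
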